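{- Let $k,\ell\geq 1$ be integers. Then $$C(P_k,P_\ell)=\begin{cases}\frac{k}{\ell} & \text{if } k>\ell \text{ and either } k \text{ is even or both } k,\ell \text{ are odd},\\ \frac{k+1}{\ell} & \text{if } k \text{ is odd and } \ell \text{ is even},\\ \frac{k+1}{\ell+1} & \text{if } k<\ell \text{ and } k \text{ is even},\\ \frac{k+\ell-r}{(a+1)\ell} & \text{if } k<\ell \text{ and } k,\ell \text{ are both odd},\end{cases}$$ where in the last case $a=\lfloor \ell/(k+1)\rfloor$ and $r=\ell-a(k+1)$ is the remainder of the division of $\ell$ by $k+1$.
   Context: All graphs are finite and simple. $P_m$ denotes the path with $m$ edges. $\operatorname{hom}(H,T)$ is the number of maps $V(H)\to V(T)$ sending every edge of $H$ to an edge of $T$, $t(H,T)=\operatorname{hom}(H,T)/v(T)^{v(H)}$, and $C(G,H)=\min\{c\in\mathbb{R}: t(G,T)\geq t(H,T)^c \text{ for all graphs } T\}$. -}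

module Defs where

open import Data.Nat as ℕ using (ℕ; zero; suc; _+_; _≡ᵇ_; _∸_; NonZero; _<_)
open import Data.Nat.DivMod using (_/_; _%_)
open import Data.Fin using (Fin; toℕ; zero; suc)
open import Data.Bool using (Bool; true; false; _∧_; _∨_; not; T)
open import Data.List using (List; []; _∷_; map; concatMap; filterᵇ; length; allFin; foldr)
open import Data.Nat.Properties using (m^n≢0)
open import Data.Bool.Properties using (∨-comm)

open import Relation.Binary.PropositionalEquality using (refl)
open import Data.Integer using (+_)
open import Data.Rational as ℚ using (ℚ; 1ℚ)
open import Data.Product using (_×_)
open import Relation.Binary.PropositionalEquality using (_≡_)
open import Relation.Nullary using (¬_)

record Graph : Set where
  field
    n      : ℕ
    adj    : Fin n → Fin n → Bool
    sym    : ∀ i j → adj i j ≡ adj j i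
    irrefl : ∀ i → adj i i ≡ false
open Graph public renaming (sym to adj-sym)

allᵇ : {A : Set} → (A → Bool) → List A → Bool
allᵇ P = foldr (λ x b → P x ∧ b) true

allMaps : (a m : ℕ) → List (Fin a → Fin m)
allMaps zero    m = (λ ()) ∷ []
allMaps (suc a) m =
  concatMap (λ f → map (λ x → λ { zero → x ; (suc i) → f i }) (allFin m)) (allMaps a m)

isHomᵇ : (H G : Graph) → (Fin (n H) → Fin (n G)) → Bool
isHomᵇ H G f =
  allᵇ (λ i → allᵇ (λ j → not (adj H i j) ∨ adj G (f i) (f j)) (allFin (n H))) (allFin (n H))

hom : Graph → Graph → ℕ
hom H G = length (filterᵇ (isHomᵇ H G) (allMaps (n H) (n G)))

-- nonempty target graphs (t(H,T) needs v(T) ≥ 1)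
record Target : Set where
  field
    graph    : Graph
    nonempty : NonZero (n graph)
open Target public


t : Graph → Target → ℚ
t H T = (+ hom H (graph T)) ℚ./ (n (graph T) ℕ.^ n H)
  where instance
    _ = nonempty T
    _ = m^n≢0 (n (graph T)) (n H) {{nonempty T}}

_^ᵣ_ : ℚ → ℕ → ℚ
x ^ᵣ zero  = 1ℚ
x ^ᵣ suc e = x ℚ.* (x ^ᵣ e)

-- "t(G,T) ≥ t(H,T)^(p/q) for all graphs T", for the nonnegative rational
-- exponent c = p/q (q ≥ 1).  Since t ∈ [0,1], this is t(H,T)^p ≤ t(G,T)^q.
Admissible : (G H : Graph) (p q : ℕ) → Set
Admissible G H p q = ∀ (T : Target) → (t H T ^ᵣ p) ℚ.≤ (t G T ^ᵣ q)

-- C(G,H) = p/q: the exponent p/q is admissible and no smaller nonnegative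
-- rational exponent p'/q' is admissible (this determines the real minimum,
-- since admissibility is upward closed in c and rationals are dense).
IsC : (G H : Graph) (p q : ℕ) → Set
IsC G H p q =
  Admissible G H p q ×
  (∀ p' q' → NonZero q' → p' ℕ.* q < p ℕ.* q' → ¬ Admissible G H p' q')

-- the path P_m with m edges, vertices 0..m, i ~ j iff |i - j| = 1
pathAdj : (m : ℕ) → Fin (suc m) → Fin (suc m) → Bool
pathAdj m i j = (suc (toℕ i) ≡ᵇ toℕ j) ∨ (suc (toℕ j) ≡ᵇ toℕ i)

pathIrr : (m : ℕ) (i : Fin (suc m)) → pathAdj m i i ≡ false
pathIrr m i = lem (toℕ i)
  where
  lem : (x : ℕ) → ((suc x ≡ᵇ x) ∨ (suc x ≡ᵇ x)) ≡ false
  lem zero = refl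
  lem (suc x) = lem x

P : ℕ → Graph
P m = record
  { n      = suc m
  ; adj    = pathAdj m
  ; sym    = λ i j → ∨-comm (suc (toℕ i) ≡ᵇ toℕ j) (suc (toℕ j) ≡ᵇ toℕ i)
  ; irrefl = pathIrr m
  }

{-# OPTIONS --safe #-}
-- Write w m for the number of walks of length m in T, a j x for the number of those of length j
-- starting at x, and n for the number of vertices; then t(P_m,T) = w m / n^{m+1}.
--
-- Upper bounds. Two applications of Hölder's inequality give everything. Over all walks x₀ … x_ℓ,
-- the functions a_{ℓ-i}(xᵢ) a_{i+1}(xᵢ₊₁) / (aᵢ(xᵢ) a_{ℓ-1-i}(xᵢ₊₁)), i < ℓ, together with 1 / a_ℓ(x₀) and
-- 1 / a_ℓ(x_ℓ), have product 1, which yields w_ℓ^{ℓ+2} ≤ n² w_{ℓ+2}^ℓ (Erdős–Simonovits for equal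
-- parities). Over all edges xy, with a = a_m, the functions a(x)²a(y)², a(x)² a_j(y) / a_{j+1}(x) and
-- a(y)² a_j(x) / a_{j+1}(y), j < m, yield w_{2m+1}^{2m+1} ≤ w_{2m}^{2m+2}. The rest is Cauchy–Schwarz,
-- cutting paths (w_{p+q+1} ≤ w_p w_q, w_{m+1} ≤ n w_m) and taking roots.
--
-- Lower bounds. Blow-ups of paths, whose layers have sizes that are powers of a parameter B → ∞:
-- regular graphs, stars, an edge-like graph with isolated vertices, and, for k < ℓ both odd, a blow-up of P_ℓ
-- in which a walk of length k sees at most one of the junctions where the edge density is 1/B.
module Submission where

open import Defs
open import Data.Nat using (ℕ; _+_; _*_; _∸_; _<_; _≤_; _/_; _%_; suc)
open import Data.Nat.Divisibility using (_∣_)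
open import Data.Product using (_×_)
open import Data.Sum using (_⊎_)
open import Relation.Nullary using (¬_)

open import Data.Nat using (zero; _^_; _!; z≤n; s≤s; _>_; _⊓_; _≡ᵇ_; _<ᵇ_; NonZero; >-nonZero)
open import Data.Nat.Properties
open import Data.Nat.Divisibility using (divides; ∣-trans; m∣m*n; n∣m*n; m≤n⇒m!∣n!; 0∣⇒≡0)
open import Data.Nat.DivMod using (m*[n/m]≡n; m/n*n≤m; m<n⇒m/n≡0; +-distrib-/-∣ʳ; m*n/n≡m; /-monoˡ-≤; m≡m%n+[m/n]*n; m%n<n)
open import Data.Nat.Tactic.RingSolver using (solve-∀)
open import Data.Bool using (Bool; true; false; not; if_then_else_; _∧_; _∨_)
open import Data.Bool.Properties using (∧-comm; ∨-comm; not-involutive)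
open import Data.Empty using (⊥-elim)
open import Data.Fin using (Fin; zero; suc; toℕ; fromℕ<; combine; remQuot; _↑ˡ_; _↑ʳ_)
open import Data.Fin.Properties using (remQuot-combine; toℕ<n; toℕ-fromℕ<)
import Data.Integer as ℤ
import Data.Integer.Properties as ℤₚ
open import Data.Integer.Properties using (pos-*)
open import Data.List using (List; []; _∷_; _++_; map; concatMap; filterᵇ; length; tabulate; allFin)
open import Data.Product using (_,_; proj₁; proj₂; Σ)
import Data.Rational as ℚ
open ℚ using (toℚᵘ)
open import Data.Rational.Properties using (toℚᵘ-fromℚᵘ; toℚᵘ-homo-*; toℚᵘ-mono-≤; toℚᵘ-cancel-≤)
import Data.Rational.Unnormalised as ℚᵘ
open ℚᵘ using (*≡*; *≤*)
import Data.Rational.Unnormalised.Properties as ℚᵘₚ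
open ℚᵘₚ using (≃-refl; ≃-trans; ≃-sym; ≤-respˡ-≃; ≤-respʳ-≃; drop-*≤*)
open import Data.Sum using (inj₁; inj₂)
open import Function using (_∘_)
open import Relation.Nullary using (yes; no)
open import Relation.Binary.PropositionalEquality using (_≡_; _≢_; refl; sym; trans; cong; cong₂; subst; subst₂)
open import Algebra.Properties.CommutativeSemigroup *-commutativeSemigroup using (interchange; x∙yz≈y∙xz)
open import Algebra.Properties.Semiring.Sum +-*-semiring using (sum; sum-cong-≗; ∑-comm; *-distribˡ-sum; *-distribʳ-sum) renaming (∑-distrib-+ to sum-distrib-+)
open ≤-Reasoning

-- Admissibility of p/q becomes an inequality w_ℓ^p ≤ n^e w_k^q between natural numbers, with e
-- forced by homogeneity under blow-ups. To stay inside ℕ, roots are traded for powers, and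
-- reciprocals of walk counts for integers D / a with one common multiple D; Hölder's inequality
-- itself has to be built in this form from AM-GM. In the case of two odd lengths the numerator k +
-- ℓ - r is the least length from ℓ on whose path has a vertex set that splits into blocks of k + 1:
-- a path is first lengthened within its parity and then cut. The layered graphs are tuned so that
-- layer p has s_p² active vertices, each with d s_q / s_p neighbours in layer q. The walks of
-- length m along a given route of layers from p to j then number s_p d^m s_j, whatever the route.
-- Only the end layers matter, so a lower bound is a choice of exponents that is large at the ends
-- of some walk of length ℓ and small at the ends of all walks of length k.

-- Powers, finite products and sums, exact division

^-distribʳ-* : ∀ m n o → (m * n) ^ o ≡ m ^ o * n ^ o
^-distribʳ-* m n zero    = refl
^-distribʳ-* m n (suc o) = trans (cong (m * n *_) (^-distribʳ-* m n o)) (interchange m n (m ^ o) (n ^ o))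

^-swap : ∀ m n o → (m ^ n) ^ o ≡ (m ^ o) ^ n
^-swap m n o = trans (^-*-assoc m n o) (trans (cong (m ^_) (*-comm n o)) (sym (^-*-assoc m o n)))

^-cancelˡ-≤ : ∀ e .{{_ : NonZero e}} {m n} → m ^ e ≤ n ^ e → m ≤ n
^-cancelˡ-≤ e {m} {n} p with m ≤? n
... | yes m≤n = m≤n
... | no  m≰n = ⊥-elim (<⇒≱ (^-monoˡ-< e (≰⇒> m≰n)) p)

∏ : ℕ → (ℕ → ℕ) → ℕ
∏ zero    f = 1
∏ (suc N) f = f 0 * ∏ N (λ j → f (suc j))

∑ : ℕ → (ℕ → ℕ) → ℕ
∑ zero    f = 0
∑ (suc N) f = f 0 + ∑ N (λ j → f (suc j))

∏-mono : ∀ N {f g} → (∀ j → j < N → f j ≤ g j) → ∏ N f ≤ ∏ N g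
∏-mono zero    h = ≤-refl
∏-mono (suc N) h = *-mono-≤ (h 0 (s≤s z≤n)) (∏-mono N (λ j j<N → h (suc j) (s≤s j<N)))

∏-cong : ∀ N {f g} → (∀ j → j < N → f j ≡ g j) → ∏ N f ≡ ∏ N g
∏-cong N h = ≤-antisym (∏-mono N (λ j p → ≤-reflexive (h j p))) (∏-mono N (λ j p → ≤-reflexive (sym (h j p))))

∏-const : ∀ N c → ∏ N (λ _ → c) ≡ c ^ N
∏-const zero    c = refl
∏-const (suc N) c = cong (c *_) (∏-const N c)

∏-distrib-* : ∀ N f g → ∏ N (λ j → f j * g j) ≡ ∏ N f * ∏ N g
∏-distrib-* zero    f g = refl
∏-distrib-* (suc N) f g = trans (cong (f 0 * g 0 *_) (∏-distrib-* N _ _)) (interchange (f 0) (g 0) _ _)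

∏-factor-∣ : ∀ N f j → j < N → f j ∣ ∏ N f
∏-factor-∣ (suc N) f zero    _         = m∣m*n _
∏-factor-∣ (suc N) f (suc j) (s≤s j<N) = ∣-trans (∏-factor-∣ N _ j j<N) (n∣m*n (f 0))

-- With g read as D / f, the factors are D f(j) / f(j+1). The factor `g 0` on the left stands for
-- the division by f(0), so that the identity needs no quotient.
∏-telescope : ∀ N D (f g : ℕ → ℕ) → (∀ j → j ≤ N → f j * g j ≡ D) →
  ∏ N (λ j → f j * g (suc j)) * g 0 ≡ D ^ N * g N
∏-telescope zero    D f g h = refl
∏-telescope (suc N) D f g h = begin-equality
  f 0 * g 1 * Π′ * g 0  ≡⟨ rearrange (f 0) (g 1) Π′ (g 0) ⟩
  f 0 * g 0 * (Π′ * g 1) ≡⟨ cong₂ _*_ (h 0 z≤n) (∏-telescope N D (λ j → f (suc j)) (λ j → g (suc j)) (λ j j≤N → h (suc j) (s≤s j≤N))) ⟩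
  D * (D ^ N * g (suc N)) ≡⟨ *-assoc D (D ^ N) _ ⟨
  D * D ^ N * g (suc N)   ∎
  where
  Π′ = ∏ N (λ j → f (suc j) * g (suc (suc j)))
  rearrange : ∀ a b c d → a * b * c * d ≡ a * d * (c * b)
  rearrange = solve-∀

∑-distrib-+ : ∀ N f g → ∑ N (λ j → f j + g j) ≡ ∑ N f + ∑ N g
∑-distrib-+ zero    f g = refl
∑-distrib-+ (suc N) f g = trans (cong (f 0 + g 0 +_) (∑-distrib-+ N _ _)) (rearrange (f 0) (g 0) _ _)
  where
  rearrange : ∀ a b c d → a + b + (c + d) ≡ a + c + (b + d)
  rearrange = solve-∀

∑-const : ∀ N {f c} → (∀ j → j < N → f j ≡ c) → ∑ N f ≡ N * c
∑-const zero    h = refl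
∑-const (suc N) h = cong₂ _+_ (h 0 (s≤s z≤n)) (∑-const N (λ j j<N → h (suc j) (s≤s j<N)))

-- The junk value of exact division by 0 is 0.
_÷_ : ℕ → ℕ → ℕ
D ÷ zero  = 0
D ÷ suc a = D / suc a

÷-exact : ∀ {D a} → a > 0 → a ∣ D → a * (D ÷ a) ≡ D
÷-exact {D} {suc a} _ a∣D = m*[n/m]≡n a∣D

÷-≤ : ∀ D a → (D ÷ a) * a ≤ D
÷-≤ D zero    = z≤n
÷-≤ D (suc a) = m/n*n≤m D (suc a)

-- Hölder's inequality without roots

2ab≤a²+b² : ∀ a b → 2 * (a * b) ≤ a * a + b * b
2ab≤a²+b² a b with ≤-total a b
... | inj₁ a≤b = subst (λ z → 2 * (a * z) ≤ a * a + z * z) (m+[n∸m]≡n a≤b) (ordered a (b ∸ a))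
  where
  expand : ∀ a c → a * a + (a + c) * (a + c) ≡ 2 * (a * (a + c)) + c * c
  expand = solve-∀
  ordered : ∀ a c → 2 * (a * (a + c)) ≤ a * a + (a + c) * (a + c)
  ordered a c = subst (2 * (a * (a + c)) ≤_) (sym (expand a c)) (m≤m+n _ _)
... | inj₂ b≤a = subst (λ z → 2 * (z * b) ≤ z * z + b * b) (m+[n∸m]≡n b≤a) (ordered b (a ∸ b))
  where
  expand : ∀ b c → (b + c) * (b + c) + b * b ≡ 2 * ((b + c) * b) + c * c
  expand = solve-∀
  ordered : ∀ b c → 2 * ((b + c) * b) ≤ (b + c) * (b + c) + b * b
  ordered b c = subst (2 * ((b + c) * b) ≤_) (sym (expand b c)) (m≤m+n _ _)

-- The tangent line of b ↦ b ^ suc n at b = a.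
tangent : ∀ n a b → suc n * (a ^ n * b) ≤ n * a ^ suc n + b ^ suc n
tangent zero    a b = ≤-reflexive (base b)
  where
  base : ∀ b → 1 * (1 * b) ≡ 0 + b * 1
  base = solve-∀
tangent (suc n) a b = +-cancelʳ-≤ (n * (a ^ suc n * b) + suc n * (a ^ n * (b * b))) _ _ (begin
  suc (suc n) * (a ^ suc n * b) + (n * (a ^ suc n * b) + suc n * (a ^ n * (b * b)))
    ≡⟨ left n a b (a ^ n) ⟩
  suc n * a ^ n * (2 * (a * b)) + suc n * (a ^ n * b) * b
    ≤⟨ +-mono-≤ (*-monoʳ-≤ (suc n * a ^ n) (2ab≤a²+b² a b)) (*-monoˡ-≤ b (tangent n a b)) ⟩
  suc n * a ^ n * (a * a + b * b) + (n * a ^ suc n + b ^ suc n) * b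
    ≡⟨ right n a b (a ^ n) (b ^ n) ⟩
  suc n * a ^ suc (suc n) + b ^ suc (suc n) + (n * (a ^ suc n * b) + suc n * (a ^ n * (b * b))) ∎)
  where
  left : ∀ n a b p → suc (suc n) * (a * p * b) + (n * (a * p * b) + suc n * (p * (b * b)))
       ≡ suc n * p * (2 * (a * b)) + suc n * (p * b) * b
  left = solve-∀
  right : ∀ n a b p q → suc n * p * (a * a + b * b) + (n * (a * p) + b * q) * b
        ≡ suc n * (a * (a * p)) + b * (b * q) + (n * (a * p * b) + suc n * (p * (b * b)))
  right = solve-∀

-- Here s is the sum of n numbers and x is one more. This is the tangent inequality at the means s/n
-- and (s+x)/(n+1), both multiplied by n(n+1); a common factor n is cancelled at the end, so n = 0
-- is treated apart.
amgm-step : ∀ n s x → suc n ^ suc n * (s ^ n * x) ≤ n ^ n * (s + x) ^ suc n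
amgm-step zero      s x = ≤-trans (≤-reflexive (base x)) (≤-trans (m≤n+m x s) (≤-reflexive (base′ (s + x))))
  where
  base : ∀ x → 1 * 1 * (1 * x) ≡ x
  base = solve-∀
  base′ : ∀ x → x ≡ 1 * (x * 1)
  base′ = solve-∀
amgm-step n@(suc _) s x = *-cancelˡ-≤ n (+-cancelʳ-≤ (n * (a ^ n * a)) _ _ (begin
  n * (suc n ^ suc n * (s ^ n * x)) + n * (a ^ n * a)
    ≡⟨ cong (λ z → n * (suc n ^ suc n * (s ^ n * x)) + n * (z * a)) (^-distribʳ-* s (suc n) n) ⟩
  n * (suc n * suc n ^ n * (s ^ n * x)) + n * (s ^ n * suc n ^ n * (s * suc n))
    ≡⟨ left n s x (suc n ^ n) (s ^ n) ⟩
  suc n * (s ^ n * suc n ^ n * (n * (s + x)))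
    ≡⟨ cong (λ z → suc n * (z * b)) (^-distribʳ-* s (suc n) n) ⟨
  suc n * (a ^ n * b)
    ≤⟨ tangent n a b ⟩
  n * (a * a ^ n) + b ^ suc n
    ≡⟨ cong₂ _+_ (cong (n *_) (*-comm a (a ^ n))) (^-distribʳ-* n (s + x) (suc n)) ⟩
  n * (a ^ n * a) + n * n ^ n * (s + x) ^ suc n
    ≡⟨ right n (a ^ n * a) (n ^ n) ((s + x) ^ suc n) ⟩
  n * (n ^ n * (s + x) ^ suc n) + n * (a ^ n * a) ∎))
  where
  a = s * suc n
  b = n * (s + x)
  left : ∀ n s x p q → n * (suc n * p * (q * x)) + n * (q * p * (s * suc n)) ≡ suc n * (q * p * (n * (s + x)))
  left = solve-∀
  right : ∀ n u v w → n * u + n * v * w ≡ n * (v * w) + n * u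
  right = solve-∀

n^n>0 : ∀ n → n ^ n > 0
n^n>0 zero    = s≤s z≤n
n^n>0 (suc n) = m^n>0 (suc n) (suc n)

amgm : ∀ N u → N ^ N * ∏ N u ≤ ∑ N u ^ N
amgm zero    u = ≤-refl
amgm (suc n) u = *-cancelˡ-≤ (n ^ n) {{>-nonZero (n^n>0 n)}} (begin
  n ^ n * (suc n ^ suc n * (u 0 * Π′)) ≡⟨ rearrange (n ^ n) (suc n ^ suc n) (u 0) Π′ ⟩
  suc n ^ suc n * (n ^ n * Π′ * u 0)   ≤⟨ *-monoʳ-≤ (suc n ^ suc n) (*-monoˡ-≤ (u 0) (amgm n _)) ⟩
  suc n ^ suc n * (S′ ^ n * u 0)       ≤⟨ amgm-step n S′ (u 0) ⟩
  n ^ n * (S′ + u 0) ^ suc n           ≡⟨ cong (λ z → n ^ n * z ^ suc n) (+-comm S′ (u 0)) ⟩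
  n ^ n * (u 0 + S′) ^ suc n           ∎)
  where
  Π′ = ∏ n (λ j → u (suc j))
  S′ = ∑ n (λ j → u (suc j))
  rearrange : ∀ p q x y → p * (q * (x * y)) ≡ q * (p * y * x)
  rearrange = solve-∀

-- c/U ≤ d/V ≤ K^{-1/N} bounds the mediant (c+d)/(U+V) by d/V.
mediant-ordered : ∀ N .{{_ : NonZero N}} K → K > 0 → ∀ c d U V → c * V ≤ d * U →
  c ^ N * K ≤ U ^ N → d ^ N * K ≤ V ^ N → (c + d) ^ N * K ≤ (U + V) ^ N
mediant-ordered N@(suc N′) K K>0 c d U zero cV≤dU hc hd = subst₂ (λ d′ U′ → (c + d′) ^ N * K ≤ U′ ^ N)
    (sym d≡0) (sym (+-identityʳ U)) (subst (λ c′ → c′ ^ N * K ≤ U ^ N) (sym (+-identityʳ c)) hc)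
  where
  d≡0 : d ≡ 0
  d≡0 with m*n≡0⇒m≡0∨n≡0 (d ^ N) (n≤0⇒n≡0 hd)
  ... | inj₁ p    = m^n≡0⇒m≡0 d N p
  ... | inj₂ refl = ⊥-elim (n≮0 K>0)
mediant-ordered N K K>0 c d U V@(suc _) cV≤dU hc hd =
  *-cancelˡ-≤ (V ^ N) {{m^n≢0 V N}} (begin
    V ^ N * ((c + d) ^ N * K)   ≡⟨ *-assoc (V ^ N) _ K ⟨
    V ^ N * (c + d) ^ N * K     ≡⟨ cong (_* K) (^-distribʳ-* V (c + d) N) ⟨
    (V * (c + d)) ^ N * K       ≤⟨ *-monoˡ-≤ K (^-monoˡ-≤ N crossed) ⟩
    (d * (U + V)) ^ N * K       ≡⟨ cong (_* K) (^-distribʳ-* d (U + V) N) ⟩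
    d ^ N * (U + V) ^ N * K     ≡⟨ rearrange (d ^ N) ((U + V) ^ N) K ⟩
    d ^ N * K * (U + V) ^ N     ≤⟨ *-monoˡ-≤ ((U + V) ^ N) hd ⟩
    V ^ N * (U + V) ^ N         ∎)
  where
  rearrange : ∀ x y z → x * y * z ≡ x * z * y
  rearrange = solve-∀
  crossed : V * (c + d) ≤ d * (U + V)
  crossed = begin
    V * (c + d)   ≡⟨ *-distribˡ-+ V c d ⟩
    V * c + V * d ≡⟨ cong₂ _+_ (*-comm V c) (*-comm V d) ⟩
    c * V + d * V ≤⟨ +-monoˡ-≤ (d * V) cV≤dU ⟩
    d * U + d * V ≡⟨ *-distribˡ-+ d U V ⟨
    d * (U + V)   ∎

mediant : ∀ N .{{_ : NonZero N}} K → K > 0 → ∀ c d U V →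
  c ^ N * K ≤ U ^ N → d ^ N * K ≤ V ^ N → (c + d) ^ N * K ≤ (U + V) ^ N
mediant N K K>0 c d U V hc hd with ≤-total (c * V) (d * U)
... | inj₁ p = mediant-ordered N K K>0 c d U V p hc hd
... | inj₂ p = subst₂ (λ x y → x ^ N * K ≤ y ^ N) (+-comm d c) (+-comm V U)
                 (mediant-ordered N K K>0 d c V U p hd hc)

-- The geometric mean is superadditive. With m = X + Z, AM-GM bounds y and z, divided by the
-- geometric mean of m, by the averages of X/m and Z/m, which add up to 1. Multiplying by D = ∏ m
-- clears the denominators; `mediant` adds the two bounds, which are only known as N-th powers.
mahler : ∀ N .{{_ : NonZero N}} (X Z : ℕ → ℕ) y z → y ^ N ≤ ∏ N X → z ^ N ≤ ∏ N Z →
  (y + z) ^ N ≤ ∏ N (λ j → X j + Z j)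
mahler N@(suc _) X Z y z hy hz with ∏ N (λ j → X j + Z j) in eq
-- A zero product cannot serve as a denominator, but then `∏ N X` and `∏ N Z` vanish as well and y =
-- z = 0.
... | zero  = ≤-reflexive (subst₂ (λ y z → (y + z) ^ N ≡ 0) (sym (vanish y X hy λ j → m≤m+n (X j) (Z j)))
                (sym (vanish z Z hz λ j → m≤n+m (Z j) (X j))) refl)
  where
  vanish : ∀ y (X′ : ℕ → ℕ) → y ^ N ≤ ∏ N X′ → (∀ j → X′ j ≤ X j + Z j) → y ≡ 0
  vanish y X′ h le = m^n≡0⇒m≡0 y N (n≤0⇒n≡0 (≤-trans h (≤-trans (∏-mono N (λ j _ → le j)) (≤-reflexive eq))))
... | D@(suc _) = *-cancelʳ-≤ _ _ K {{>-nonZero K>0}} (*-cancelˡ-≤ (N ^ N) {{m^n≢0 N N}} (begin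
    N ^ N * ((y + z) ^ N * K)     ≡⟨ *-assoc (N ^ N) _ K ⟨
    N ^ N * (y + z) ^ N * K       ≡⟨ cong (_* K) (^-distribʳ-* N (y + z) N) ⟨
    (N * (y + z)) ^ N * K         ≡⟨ cong (λ t → t ^ N * K) (*-distribˡ-+ N y z) ⟩
    (N * y + N * z) ^ N * K       ≤⟨ mediant N K K>0 (N * y) (N * z) (∑ N (λ j → X j * C j)) (∑ N (λ j → Z j * C j)) (scaled y X hy) (scaled z Z hz) ⟩
    (∑ N (λ j → X j * C j) + ∑ N (λ j → Z j * C j)) ^ N ≡⟨ cong (_^ N) total ⟩
    (N * D) ^ N                   ≡⟨ ^-distribʳ-* N D N ⟩
    N ^ N * D ^ N                 ≡⟨ cong (N ^ N *_) D^N ⟩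
    N ^ N * (D * K)               ∎))
  where
  m C : ℕ → ℕ
  m j = X j + Z j
  C j = D ÷ m j
  K = ∏ N C
  m∣D : ∀ j → j < N → m j ∣ D
  m∣D j j<N = subst (m j ∣_) eq (∏-factor-∣ N m j j<N)
  mC : ∀ j → j < N → m j * C j ≡ D
  mC j j<N with m j in mj | m∣D j j<N
  ... | zero  | 0∣D = ⊥-elim (0≢1+n (sym (0∣⇒≡0 0∣D)))
  ... | suc _ | m∣  = ÷-exact (s≤s z≤n) m∣
  D^N : D ^ N ≡ D * K
  D^N = begin-equality
    D ^ N                   ≡⟨ ∏-const N D ⟨
    ∏ N (λ _ → D)           ≡⟨ ∏-cong N (λ j j<N → mC j j<N) ⟨
    ∏ N (λ j → m j * C j)   ≡⟨ ∏-distrib-* N m C ⟩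
    ∏ N m * K               ≡⟨ cong (_* K) eq ⟩
    D * K                   ∎
  K>0 : K > 0
  K>0 = n≢0⇒n>0 (λ K≡0 → n>0⇒n≢0 (m^n>0 D N) (trans D^N (trans (cong (D *_) K≡0) (*-zeroʳ D))))
  scaled : ∀ y X → y ^ N ≤ ∏ N X → (N * y) ^ N * K ≤ ∑ N (λ j → X j * C j) ^ N
  scaled y X hy = begin
    (N * y) ^ N * K             ≡⟨ cong (_* K) (^-distribʳ-* N y N) ⟩
    N ^ N * y ^ N * K           ≡⟨ *-assoc (N ^ N) _ K ⟩
    N ^ N * (y ^ N * K)         ≤⟨ *-monoʳ-≤ (N ^ N) (*-monoˡ-≤ K hy) ⟩
    N ^ N * (∏ N X * K)         ≡⟨ cong (N ^ N *_) (∏-distrib-* N X C) ⟨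
    N ^ N * ∏ N (λ j → X j * C j) ≤⟨ amgm N (λ j → X j * C j) ⟩
    ∑ N (λ j → X j * C j) ^ N   ∎
  total : ∑ N (λ j → X j * C j) + ∑ N (λ j → Z j * C j) ≡ N * D
  total = begin-equality
    ∑ N (λ j → X j * C j) + ∑ N (λ j → Z j * C j) ≡⟨ ∑-distrib-+ N (λ j → X j * C j) (λ j → Z j * C j) ⟨
    ∑ N (λ j → X j * C j + Z j * C j)
      ≡⟨ ∑-const N (λ j j<N → trans (sym (*-distribʳ-+ (C j) (X j) (Z j))) (mC j j<N)) ⟩
    N * D ∎

sum-mono : ∀ {m} {f g : Fin m → ℕ} → (∀ i → f i ≤ g i) → sum f ≤ sum g
sum-mono {zero}  h = z≤n
sum-mono {suc m} h = +-mono-≤ (h zero) (sum-mono (λ i → h (suc i)))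

sum-const : ∀ m c → sum {m} (λ _ → c) ≡ m * c
sum-const zero    c = refl
sum-const (suc m) c = cong (c +_) (sum-const m c)

term≤sum : ∀ {m} (f : Fin m → ℕ) i → f i ≤ sum f
term≤sum f zero    = m≤m+n _ _
term≤sum f (suc i) = ≤-trans (term≤sum (λ j → f (suc j)) i) (m≤n+m _ _)

sum-bound : ∀ {m} (f : Fin m → ℕ) c → (∀ i → f i ≤ c) → sum f ≤ m * c
sum-bound {m} f c h = ≤-trans (sum-mono h) (≤-reflexive (sum-const m c))

-- Induction on the number of summands: Mahler's inequality splits off one summand from all N sums
-- at once.
hölder-sum : ∀ N .{{_ : NonZero N}} {m} (y : Fin m → ℕ) (X : ℕ → Fin m → ℕ) →
  (∀ i → y i ^ N ≤ ∏ N (λ j → X j i)) → sum y ^ N ≤ ∏ N (λ j → sum (X j))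
hölder-sum (suc N) {zero}  y X h = z≤n
hölder-sum N       {suc m} y X h = mahler N (λ j → X j zero) (λ j → sum (λ i → X j (suc i))) _ _ (h zero)
  (hölder-sum N (λ i → y (suc i)) (λ j i → X j (suc i)) (λ i → h (suc i)))

𝟙 : Bool → ℕ
𝟙 b = if b then 1 else 0

𝟙-∧ : ∀ b c → 𝟙 (b ∧ c) ≡ 𝟙 b * 𝟙 c
𝟙-∧ true  c = sym (+-identityʳ (𝟙 c))
𝟙-∧ false c = refl

𝟙≤1 : ∀ b → 𝟙 b ≤ 1
𝟙≤1 true  = ≤-refl
𝟙≤1 false = z≤n

-- Walks

module Walks (G : Graph) where

  V : Set
  V = Fin (n G)

  A : V → V → ℕ
  A x y = 𝟙 (adj G x y)

  A-sym : ∀ x y → A x y ≡ A y x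
  A-sym x y = cong 𝟙 (adj-sym G x y)

  a : ℕ → V → ℕ
  a zero    x = 1
  a (suc j) x = sum (λ y → A x y * a j y)

  w : ℕ → ℕ
  w j = sum (a j)

  w-zero : w 0 ≡ n G
  w-zero = trans (sum-const (n G) 1) (*-identityʳ (n G))

  -- Self-adjointness of the adjacency matrix.
  sum-A-swap : ∀ (f g : V → ℕ) →
    sum (λ x → f x * sum (λ y → A x y * g y)) ≡ sum (λ y → sum (λ x → A y x * f x) * g y)
  sum-A-swap f g = begin-equality
    sum (λ x → f x * sum (λ y → A x y * g y)) ≡⟨ sum-cong-≗ (λ x → *-distribˡ-sum (f x) (λ y → A x y * g y)) ⟩
    sum (λ x → sum (λ y → f x * (A x y * g y))) ≡⟨ ∑-comm (λ x y → f x * (A x y * g y)) ⟩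
    sum (λ y → sum (λ x → f x * (A x y * g y))) ≡⟨ sum-cong-≗ (λ y → sum-cong-≗ (λ x → flip x y)) ⟩
    sum (λ y → sum (λ x → A y x * f x * g y)) ≡⟨ sum-cong-≗ (λ y → *-distribʳ-sum (g y) (λ x → A y x * f x)) ⟨
    sum (λ y → sum (λ x → A y x * f x) * g y) ∎
    where
    rearrange : ∀ u v z → u * (v * z) ≡ v * u * z
    rearrange = solve-∀
    flip : ∀ x y → f x * (A x y * g y) ≡ A y x * f x * g y
    flip x y = trans (rearrange (f x) (A x y) (g y)) (cong (λ z → z * f x * g y) (A-sym x y))

  -- A walk of length p + q is cut at its p-th vertex; self-adjointness moves one step at a time
  -- across the cut.
  a-inner : ∀ p q → sum (λ x → a p x * a q x) ≡ w (p + q)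
  a-inner zero    q = sum-cong-≗ (λ x → +-identityʳ (a q x))
  a-inner (suc p) q = begin-equality
    sum (λ x → a (suc p) x * a q x) ≡⟨ sum-A-swap (a p) (a q) ⟨
    sum (λ x → a p x * a (suc q) x) ≡⟨ a-inner p (suc q) ⟩
    w (p + suc q)                   ≡⟨ cong w (+-suc p q) ⟩
    w (suc (p + q))                 ∎

  a≤n^ : ∀ j x → a j x ≤ n G ^ j
  a≤n^ zero    x = ≤-refl
  a≤n^ (suc j) x = sum-bound (λ y → A x y * a j y) (n G ^ j) (λ y → ≤-trans (*-mono-≤ (𝟙≤1 (adj G x y)) (a≤n^ j y)) (≤-reflexive (+-identityʳ _)))

  -- Going back and forth along one edge gives walks of every length.
  a-pos : ∀ j x y → A x y ≡ 1 → a j x > 0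
  a-pos zero    x y e = s≤s z≤n
  a-pos (suc j) x y e = begin-strict
    0             <⟨ a-pos j y x (trans (A-sym y x) e) ⟩
    a j y         ≡⟨ +-identityʳ (a j y) ⟨
    1 * a j y     ≡⟨ cong (_* a j y) e ⟨
    A x y * a j y ≤⟨ term≤sum (λ y → A x y * a j y) y ⟩
    a (suc j) x   ∎

  w-split : ∀ p q → w (p + suc q) ≤ w p * w q
  w-split p q = begin
    w (p + suc q)                   ≡⟨ a-inner p (suc q) ⟨
    sum (λ x → a p x * a (suc q) x) ≤⟨ sum-mono (λ x → *-monoʳ-≤ (a p x) (sum-mono (drop x))) ⟩
    sum (λ x → a p x * w q)         ≡⟨ *-distribʳ-sum (w q) (a p) ⟨
    w p * w q                       ∎
    where
    drop : ∀ x y → A x y * a q y ≤ a q y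
    drop x y = ≤-trans (*-monoˡ-≤ (a q y) (𝟙≤1 (adj G x y))) (≤-reflexive (+-identityʳ _))

  w-step : ∀ m → w (suc m) ≤ n G * w m
  w-step m = subst (λ v → w (suc m) ≤ v * w m) w-zero (w-split 0 m)

  w-cauchy : ∀ p q → w (p + q) ^ 2 ≤ w (p + p) * w (q + q)
  w-cauchy p q = begin
    w (p + q) ^ 2                     ≡⟨ cong (_^ 2) (a-inner p q) ⟨
    sum (λ x → a p x * a q x) ^ 2     ≤⟨ hölder-sum 2 (λ x → a p x * a q x) X (λ x → ≤-reflexive (square (a p x) (a q x))) ⟩
    sum (X 0) * (sum (X 1) * 1)       ≡⟨ cong₂ _*_ (a-inner p p) (trans (*-identityʳ _) (a-inner q q)) ⟩
    w (p + p) * w (q + q)             ∎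
    where
    X : ℕ → V → ℕ
    X zero    x = a p x * a p x
    X (suc _) x = a q x * a q x
    square : ∀ u v → u * v * (u * v * 1) ≡ u * u * (v * v * 1)
    square = solve-∀

-- hom (P m) G counts walks

lsum : ∀ {X : Set} → (X → ℕ) → List X → ℕ
lsum φ []       = 0
lsum φ (x ∷ xs) = φ x + lsum φ xs

lsum-++ : ∀ {X : Set} (φ : X → ℕ) xs ys → lsum φ (xs ++ ys) ≡ lsum φ xs + lsum φ ys
lsum-++ φ []       ys = refl
lsum-++ φ (x ∷ xs) ys = trans (cong (φ x +_) (lsum-++ φ xs ys)) (sym (+-assoc (φ x) _ _))

lsum-cong : ∀ {X : Set} {φ ψ : X → ℕ} → (∀ x → φ x ≡ ψ x) → ∀ xs → lsum φ xs ≡ lsum ψ xs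
lsum-cong h []       = refl
lsum-cong h (x ∷ xs) = cong₂ _+_ (h x) (lsum-cong h xs)

length-filterᵇ : ∀ {X : Set} p (xs : List X) → length (filterᵇ p xs) ≡ lsum (𝟙 ∘ p) xs
length-filterᵇ p []       = refl
length-filterᵇ p (x ∷ xs) with p x
... | true  = cong suc (length-filterᵇ p xs)
... | false = length-filterᵇ p xs

lsum-map-tabulate : ∀ {X Y : Set} (φ : X → ℕ) (g : Y → X) {m} (f : Fin m → Y) →
  lsum φ (map g (tabulate f)) ≡ sum (λ i → φ (g (f i)))
lsum-map-tabulate φ g {zero}  f = refl
lsum-map-tabulate φ g {suc m} f = cong (φ (g (f zero)) +_) (lsum-map-tabulate φ g (λ i → f (suc i)))

lsum-concatMap : ∀ {X Y : Set} (φ : X → ℕ) (h : Y → List X) ys → lsum φ (concatMap h ys) ≡ lsum (λ y → lsum φ (h y)) ys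
lsum-concatMap φ h []       = refl
lsum-concatMap φ h (y ∷ ys) = trans (lsum-++ φ (h y) _) (cong (lsum φ (h y) +_) (lsum-concatMap φ h ys))

allᵇ-tabulate⁻ : ∀ {X : Set} (p : X → Bool) {m} (f : Fin m → X) → allᵇ p (tabulate f) ≡ true → ∀ i → p (f i) ≡ true
allᵇ-tabulate⁻ p {suc m} f h i with p (f zero) in eq
allᵇ-tabulate⁻ p {suc m} f h zero    | true = eq
allᵇ-tabulate⁻ p {suc m} f h (suc i) | true = allᵇ-tabulate⁻ p (λ j → f (suc j)) h i

allᵇ-tabulate⁺ : ∀ {X : Set} (p : X → Bool) {m} (f : Fin m → X) → (∀ i → p (f i) ≡ true) → allᵇ p (tabulate f) ≡ true
allᵇ-tabulate⁺ p {zero}  f h = refl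
allᵇ-tabulate⁺ p {suc m} f h rewrite h zero = allᵇ-tabulate⁺ p (λ j → f (suc j)) (λ i → h (suc i))

true-iff⇒≡ : ∀ {b c} → (b ≡ true → c ≡ true) → (c ≡ true → b ≡ true) → b ≡ c
true-iff⇒≡ {true}          f g = sym (f refl)
true-iff⇒≡ {false} {true}  f g = g refl
true-iff⇒≡ {false} {false} f g = refl

module PathHom (G : Graph) where
  open Walks G

  walkᵇ : ∀ m → (Fin (suc m) → V) → Bool
  walkᵇ zero    f = true
  walkᵇ (suc m) f = adj G (f zero) (f (suc zero)) ∧ walkᵇ m (f ∘ suc)

  edgeOK : ∀ m → (Fin (suc m) → V) → Fin (suc m) → Fin (suc m) → Bool
  edgeOK m f i j = not (pathAdj m i j) ∨ adj G (f i) (f j)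

  walk⇒edges : ∀ m f → walkᵇ m f ≡ true → ∀ i j → edgeOK m f i j ≡ true
  walk⇒edges zero    f h zero    zero    = refl
  walk⇒edges (suc m) f h i j with adj G (f zero) (f (suc zero)) in eq
  walk⇒edges (suc m) f h zero          zero          | true = refl
  walk⇒edges (suc m) f h zero          (suc zero)    | true = eq
  walk⇒edges (suc m) f h zero          (suc (suc j)) | true = refl
  walk⇒edges (suc m) f h (suc zero)    zero          | true = trans (adj-sym G _ _) eq
  walk⇒edges (suc m) f h (suc (suc i)) zero          | true = refl
  walk⇒edges (suc m) f h (suc i)       (suc j)       | true = walk⇒edges m (f ∘ suc) h i j

  edges⇒walk : ∀ m f → (∀ i j → edgeOK m f i j ≡ true) → walkᵇ m f ≡ true
  edges⇒walk zero    f h = refl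
  edges⇒walk (suc m) f h rewrite h zero (suc zero) = edges⇒walk m (f ∘ suc) (λ i j → h (suc i) (suc j))

  isHom≡walk : ∀ m f → isHomᵇ (P m) G f ≡ walkᵇ m f
  isHom≡walk m f = true-iff⇒≡
    (λ h → edges⇒walk m f (λ i j → allᵇ-tabulate⁻ (edgeOK m f i) (λ k → k)
      (allᵇ-tabulate⁻ (λ i → allᵇ (edgeOK m f i) (allFin (suc m))) (λ k → k) h i) j))
    (λ h → allᵇ-tabulate⁺ (λ i → allᵇ (edgeOK m f i) (allFin (suc m))) (λ k → k)
      (λ i → allᵇ-tabulate⁺ (edgeOK m f i) (λ k → k) (walk⇒edges m f h i)))

  -- `allMaps` prepends a new first vertex x to each map. Summing over x replaces the weight c by
  -- its image under the adjacency matrix, now a weight on the old first vertex, so the induction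
  -- has to run over all weights.
  count-walks : ∀ m (c : V → ℕ) →
    lsum (λ f → c (f zero) * 𝟙 (walkᵇ m f)) (allMaps (suc m) (n G)) ≡ sum (λ x → c x * a m x)
  count-walks zero    c = trans (lsum-++ (λ (f : Fin 1 → V) → c (f zero) * 1) (map _ (allFin (n G))) [])
    (trans (+-identityʳ _) (lsum-map-tabulate (λ (f : Fin 1 → V) → c (f zero) * 1) _ {n G} (λ k → k)))
  count-walks (suc m) c = begin-equality
    lsum (λ f → c (f zero) * 𝟙 (walkᵇ (suc m) f)) (allMaps (suc (suc m)) (n G))
      ≡⟨ lsum-concatMap _ _ (allMaps (suc m) (n G)) ⟩
    _ ≡⟨ lsum-cong first-step (allMaps (suc m) (n G)) ⟩
    lsum (λ f → sum (λ x → A (f zero) x * c x) * 𝟙 (walkᵇ m f)) (allMaps (suc m) (n G))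
      ≡⟨ count-walks m (λ y → sum (λ x → A y x * c x)) ⟩
    sum (λ y → sum (λ x → A y x * c x) * a m y)
      ≡⟨ sum-A-swap c (a m) ⟨
    sum (λ x → c x * a (suc m) x) ∎
    where
    rearrange : ∀ u v z → u * (v * z) ≡ v * u * z
    rearrange = solve-∀
    first-step : ∀ (f : Fin (suc m) → V) → _ ≡ sum (λ x → A (f zero) x * c x) * 𝟙 (walkᵇ m f)
    first-step f = trans (lsum-map-tabulate (λ f → c (f zero) * 𝟙 (walkᵇ (suc m) f)) _ {n G} (λ k → k)) (trans
      (sum-cong-≗ (λ x → trans (cong (c x *_) (trans (𝟙-∧ (adj G x (f zero)) (walkᵇ m f)) (cong (_* 𝟙 (walkᵇ m f)) (A-sym x (f zero)))))
         (rearrange (c x) (A (f zero) x) (𝟙 (walkᵇ m f)))))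
      (sym (*-distribʳ-sum (𝟙 (walkᵇ m f)) (λ x → A (f zero) x * c x))))

  hom≡w : ∀ m → hom (P m) G ≡ w m
  hom≡w m = begin-equality
    hom (P m) G ≡⟨ length-filterᵇ (isHomᵇ (P m) G) (allMaps (suc m) (n G)) ⟩
    lsum (𝟙 ∘ isHomᵇ (P m) G) (allMaps (suc m) (n G))
      ≡⟨ lsum-cong (λ f → trans (cong 𝟙 (isHom≡walk m f)) (sym (+-identityʳ (𝟙 (walkᵇ m f))))) (allMaps (suc m) (n G)) ⟩
    lsum (λ f → 1 * 𝟙 (walkᵇ m f)) (allMaps (suc m) (n G)) ≡⟨ count-walks m (λ _ → 1) ⟩
    sum (λ x → 1 * a m x) ≡⟨ sum-cong-≗ (λ x → +-identityʳ (a m x)) ⟩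
    w m ∎

-- Hölder's inequality over walks and its two applications

interleave : ∀ {X : Set} → (ℕ → X) → (ℕ → X) → ℕ → X
interleave F G zero          = F 0
interleave F G (suc zero)    = G 0
interleave F G (suc (suc j)) = interleave (F ∘ suc) (G ∘ suc) j

-- The map h is arbitrary because the same list of functions is used twice: evaluated at one edge,
-- and through total masses over all edges.
∏-interleave : ∀ {X : Set} (h : X → ℕ) m F G →
  ∏ (m * 2) (λ j → h (interleave F G j)) ≡ ∏ m (λ j → h (F j) * h (G j))
∏-interleave h zero    F G = refl
∏-interleave h (suc m) F G = trans (sym (*-assoc (h (F 0)) _ _)) (cong (h (F 0) * h (G 0) *_) (∏-interleave h m (F ∘ suc) (G ∘ suc)))

m+m≡m*2 : ∀ m → m + m ≡ m * 2
m+m≡m*2 = solve-∀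

-- An indicator equals each of its positive powers, so it may be attached to every factor.
weighted-hölder : ∀ N .{{_ : NonZero N}} b y (X : ℕ → ℕ) → (b ≡ true → y ^ N ≤ ∏ N X) →
  (𝟙 b * y) ^ N ≤ ∏ N (λ j → 𝟙 b * X j)
weighted-hölder (suc N) false y X h = z≤n
weighted-hölder N       true  y X h = begin
  (1 * y) ^ N           ≡⟨ cong (_^ N) (*-identityˡ y) ⟩
  y ^ N                 ≤⟨ h refl ⟩
  ∏ N X                 ≡⟨ ∏-cong N (λ j _ → *-identityˡ (X j)) ⟨
  ∏ N (λ j → 1 * X j)   ∎

-- A walk is a sequence of vertices of which only the first entries matter;
-- W ℓ g x sums g over the walks of length ℓ starting at x.
module WalkSums (G : Graph) where
  open Walks G

  _▹_ : V → (ℕ → V) → ℕ → V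
  (x ▹ v) zero    = x
  (x ▹ v) (suc i) = v i

  W : ℕ → ((ℕ → V) → ℕ) → V → ℕ
  W zero    g x = g (λ _ → x)
  W (suc ℓ) g x = sum (λ y → A x y * W ℓ (λ v → g (x ▹ v)) y)

  Steps : ℕ → (ℕ → V) → Set
  Steps ℓ v = ∀ i → i < ℓ → A (v i) (v (suc i)) ≡ 1

  ▹-steps : ∀ {ℓ x z v} → A x z ≡ 1 → v 0 ≡ z → Steps ℓ v → Steps (suc ℓ) (x ▹ v)
  ▹-steps e refl s zero    _       = e
  ▹-steps e refl s (suc i) (s≤s p) = s i p

  -- One application of `hölder-sum` for each step of the walk. The pointwise hypothesis is
  -- restricted to genuine walks because only there are the counts in the denominators known to be
  -- positive.
  hölder-W : ∀ N .{{_ : NonZero N}} ℓ x (y : (ℕ → V) → ℕ) (X : ℕ → (ℕ → V) → ℕ) →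
    (∀ v → v 0 ≡ x → Steps ℓ v → y v ^ N ≤ ∏ N (λ j → X j v)) →
    W ℓ y x ^ N ≤ ∏ N (λ j → W ℓ (X j) x)
  hölder-W N zero    x y X h = h (λ _ → x) refl (λ _ ())
  hölder-W N (suc ℓ) x y X h = hölder-sum N _ (λ j z → A x z * W ℓ (λ v → X j (x ▹ v)) z) (λ z →
    weighted-hölder N (adj G x z) (W ℓ (λ v → y (x ▹ v)) z) (λ j → W ℓ (λ v → X j (x ▹ v)) z) (λ e →
      hölder-W N ℓ z (λ v → y (x ▹ v)) (λ j v → X j (x ▹ v)) (λ v v0 s →
        h (x ▹ v) refl (▹-steps (cong 𝟙 e) v0 s))))

  hölder-walks : ∀ N .{{_ : NonZero N}} ℓ (y : (ℕ → V) → ℕ) (X : ℕ → (ℕ → V) → ℕ) →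
    (∀ v → Steps ℓ v → y v ^ N ≤ ∏ N (λ j → X j v)) →
    sum (W ℓ y) ^ N ≤ ∏ N (λ j → sum (W ℓ (X j)))
  hölder-walks N ℓ y X h = hölder-sum N (W ℓ y) (λ j → W ℓ (X j)) (λ x → hölder-W N ℓ x y X (λ v _ → h v))

  W-head : ∀ ℓ (g : V → ℕ) x → W ℓ (λ v → g (v 0)) x ≡ g x * a ℓ x
  W-head zero    g x = sym (*-identityʳ (g x))
  W-head (suc ℓ) g x = begin-equality
    sum (λ y → A x y * W ℓ (λ _ → g x) y)   ≡⟨ sum-cong-≗ (λ y → cong (A x y *_) (W-head ℓ (λ _ → g x) y)) ⟩
    sum (λ y → A x y * (g x * a ℓ y))       ≡⟨ sum-cong-≗ (λ y → x∙yz≈y∙xz (A x y) (g x) (a ℓ y)) ⟩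
    sum (λ y → g x * (A x y * a ℓ y))       ≡⟨ *-distribˡ-sum (g x) (λ y → A x y * a ℓ y) ⟨
    g x * a (suc ℓ) x                       ∎

  -- A function of the i-th edge xy is weighted by the walks arriving at x and those leaving y. The
  -- weight `a p` records the steps already absorbed on the left, which lets the induction on i go
  -- through.
  W-edge-weighted : ∀ p i q (f : V → V → ℕ) →
    sum (λ x → a p x * W (i + suc q) (λ v → f (v i) (v (suc i))) x) ≡
    sum (λ x → a (i + p) x * sum (λ y → A x y * (f x y * a q y)))
  W-edge-weighted p zero    q f = sum-cong-≗ (λ x → cong (a p x *_) (sum-cong-≗ (λ y → cong (A x y *_) (W-head q (f x) y))))
  W-edge-weighted p (suc i) q f = begin-equality
    sum (λ x → a p x * sum (λ y → A x y * W′ y)) ≡⟨ sum-A-swap (a p) W′ ⟩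
    sum (λ y → a (suc p) y * W′ y)               ≡⟨ W-edge-weighted (suc p) i q f ⟩
    sum (λ x → a (i + suc p) x * E x)            ≡⟨ cong (λ e → sum (λ x → a e x * E x)) (+-suc i p) ⟩
    sum (λ x → a (suc i + p) x * E x)            ∎
    where
    W′ = W (i + suc q) (λ v → f (v i) (v (suc i)))
    E : V → ℕ
    E x = sum (λ y → A x y * (f x y * a q y))

  W-edge : ∀ i q (f : V → V → ℕ) → sum (W (i + suc q) (λ v → f (v i) (v (suc i)))) ≡
    sum (λ x → a i x * sum (λ y → A x y * (f x y * a q y)))
  W-edge i q f = begin-equality
    sum (W (i + suc q) g)                  ≡⟨ sum-cong-≗ (λ x → +-identityʳ (W (i + suc q) g x)) ⟨
    sum (λ x → 1 * W (i + suc q) g x)      ≡⟨ W-edge-weighted 0 i q f ⟩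
    sum (λ x → a (i + 0) x * E x)          ≡⟨ cong (λ e → sum (λ x → a e x * E x)) (+-identityʳ i) ⟩
    sum (λ x → a i x * E x)                ∎
    where
    g : (ℕ → V) → ℕ
    g v = f (v i) (v (suc i))
    E : V → ℕ
    E x = sum (λ y → A x y * (f x y * a q y))

  steps-pos : ∀ L v → Steps (suc L) v → ∀ i → i ≤ suc L → ∀ j → a j (v i) > 0
  steps-pos L v s zero    _       j = a-pos j (v 0) (v 1) (s 0 (s≤s z≤n))
  steps-pos L v s (suc i) (s≤s p) j = a-pos j (v (suc i)) (v i) (trans (A-sym (v (suc i)) (v i)) (s i (s≤s p)))

  V-nonZero : V → NonZero (n G)
  V-nonZero x with n G
  V-nonZero () | zero
  V-nonZero _  | suc _ = _

  -- D is a common multiple of the positive a j x with j ≤ ℓ, so that b j x / D is 1 / a j x.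
  module Denominator (ℓ : ℕ) where

    D : ℕ
    D = (n G ^ ℓ) !

    D>0 : D > 0
    D>0 = 1≤n! (n G ^ ℓ)

    b : ℕ → V → ℕ
    b j x = D ÷ a j x

    -- A positive count that is at most n^ℓ is one of the factors of the factorial D.
    a*b : ∀ j x → j ≤ ℓ → a j x > 0 → a j x * b j x ≡ D
    a*b j x j≤ℓ a>0 = ÷-exact a>0 (positive-∣-! a>0 (≤-trans (a≤n^ j x) (^-monoʳ-≤ (n G) {{V-nonZero x}} j≤ℓ)))
      where
      positive-∣-! : ∀ {m o} → m > 0 → m ≤ o → m ∣ o !
      positive-∣-! {suc m} _ m≤o = ∣-trans (m∣m*n (m !)) (m≤n⇒m!∣n! m≤o)

    -- The exact product is for vertices on walks; the masses are sums over all vertices, where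
    -- isolated ones have count 0, and this inequality bounds them.
    b*a≤D : ∀ j x → b j x * a j x ≤ D
    b*a≤D j x = ÷-≤ D (a j x)

  -- X 0 and X 1 stand for 1 / a_ℓ(x₀) and 1 / a_ℓ(x_ℓ), of total mass ≤ n; every other X has mass w (2 + ℓ).
  module InsertTwoSteps (L : ℕ) where

    ℓ = suc L
    open Denominator ℓ

    back forth : ℕ → (ℕ → V) → ℕ
    back  i v = a (ℓ ∸ i) (v i) * b (L ∸ i) (v (suc i))
    forth i v = b i (v i) * a (suc i) (v (suc i))

    X : ℕ → (ℕ → V) → ℕ
    X zero          v = D * b ℓ (v 0)
    X (suc zero)    v = D * b ℓ (v ℓ)
    X (suc (suc i)) v = back i v * forth i v

    -- The quotients in `back` telescope to a_ℓ(x₀), those in `forth` to a_ℓ(x_ℓ), and `X 0`, `X 1`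
    -- cancel these two. Each `X j` carries the scale D²: one D each from `back` and `forth`, while
    -- the explicit D in `X 0` and `X 1` brings them to the same scale.
    product≡ : ∀ v → Steps ℓ v → ∏ (2 + ℓ) (λ j → X j v) ≡ (D * D) ^ (2 + ℓ)
    product≡ v s = begin-equality
      D * b ℓ (v 0) * (D * b ℓ (v ℓ) * ∏ ℓ (λ i → back i v * forth i v))
        ≡⟨ cong (λ z → D * b ℓ (v 0) * (D * b ℓ (v ℓ) * z)) (∏-distrib-* ℓ (λ i → back i v) (λ i → forth i v)) ⟩
      D * b ℓ (v 0) * (D * b ℓ (v ℓ) * (∏ ℓ (λ i → back i v) * ∏ ℓ (λ i → forth i v)))
        ≡⟨ rearrange₁ D (b ℓ (v 0)) (b ℓ (v ℓ)) (∏ ℓ (λ i → back i v)) (∏ ℓ (λ i → forth i v)) ⟩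
      D * D * (∏ ℓ (λ i → back i v) * b ℓ (v 0) * (∏ ℓ (λ i → forth i v) * 1 * b ℓ (v ℓ)))
        ≡⟨ cong₂ (λ p q → D * D * (p * (q * b ℓ (v ℓ)))) backs forths ⟩
      D * D * (D ^ ℓ * b (ℓ ∸ ℓ) (v ℓ) * (D ^ ℓ * a ℓ (v ℓ) * b ℓ (v ℓ)))
        ≡⟨ cong₂ (λ p q → D * D * (D ^ ℓ * p * q)) b₀ (trans (*-assoc (D ^ ℓ) _ _) (cong (D ^ ℓ *_) (a*b ℓ (v ℓ) ≤-refl (pos ℓ ≤-refl ℓ)))) ⟩
      D * D * (D ^ ℓ * D * (D ^ ℓ * D))
        ≡⟨ rearrange₂ D (D ^ ℓ) ⟩
      D * D * (D * D * (D ^ ℓ * D ^ ℓ))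
        ≡⟨ cong (λ z → D * D * (D * D * z)) (^-distribʳ-* D D ℓ) ⟨
      (D * D) ^ (2 + ℓ) ∎
      where
      pos = steps-pos L v s
      rearrange₁ : ∀ d b₀ b₁ p q → d * b₀ * (d * b₁ * (p * q)) ≡ d * d * (p * b₀ * (q * 1 * b₁))
      rearrange₁ = solve-∀
      rearrange₂ : ∀ d e → d * d * (e * d * (e * d)) ≡ d * d * (d * d * (e * e))
      rearrange₂ = solve-∀
      backs : ∏ ℓ (λ i → back i v) * b ℓ (v 0) ≡ D ^ ℓ * b (ℓ ∸ ℓ) (v ℓ)
      backs = ∏-telescope ℓ D (λ i → a (ℓ ∸ i) (v i)) (λ i → b (ℓ ∸ i) (v i))
        (λ j j≤ℓ → a*b (ℓ ∸ j) (v j) (m∸n≤m ℓ j) (pos j j≤ℓ (ℓ ∸ j)))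
      -- The roles are exchanged: the reciprocals `b` are telescoped against the counts `a`, and the
      -- factor 1 is `a 0 (v 0)`.
      forths : ∏ ℓ (λ i → forth i v) * 1 ≡ D ^ ℓ * a ℓ (v ℓ)
      forths = ∏-telescope ℓ D (λ i → b i (v i)) (λ i → a i (v i))
        (λ j j≤ℓ → trans (*-comm (b j (v j)) _) (a*b j (v j) j≤ℓ (pos j j≤ℓ j)))
      b₀ : b (ℓ ∸ ℓ) (v ℓ) ≡ D
      b₀ = trans (cong (λ e → b e (v ℓ)) (n∸n≡0 ℓ)) (trans (sym (*-identityˡ _)) (a*b 0 (v ℓ) z≤n (s≤s z≤n)))

    -- The walks starting at x cancel the denominator a_ℓ(x), so each vertex contributes at most D².
    endpoint-mass : sum (λ x → D * b ℓ x * a ℓ x) ≤ n G * (D * D)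
    endpoint-mass = sum-bound (λ x → D * b ℓ x * a ℓ x) (D * D)
      (λ x → ≤-trans (≤-reflexive (*-assoc D (b ℓ x) (a ℓ x))) (*-monoʳ-≤ D (b*a≤D ℓ x)))

    start-mass : sum (W ℓ (X 0)) ≤ n G * (D * D)
    start-mass = ≤-trans (≤-reflexive (sum-cong-≗ (W-head ℓ (λ x → D * b ℓ x)))) endpoint-mass

    end-mass : sum (W ℓ (X 1)) ≤ n G * (D * D)
    end-mass = begin
      sum (W ℓ (X 1))            ≡⟨ cong (λ e → sum (W e (X 1))) (+-comm L 1) ⟨
      sum (W (L + 1) (X 1))      ≡⟨ W-edge L 0 (λ _ y → D * b ℓ y) ⟩
      sum (λ x → a L x * sum (λ y → A x y * (D * b ℓ y * 1))) ≡⟨ sum-A-swap (a L) (λ y → D * b ℓ y * 1) ⟩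
      sum (λ y → a ℓ y * (D * b ℓ y * 1)) ≡⟨ sum-cong-≗ (λ y → rearrange (a ℓ y) (D * b ℓ y)) ⟩
      sum (λ y → D * b ℓ y * a ℓ y)       ≤⟨ endpoint-mass ⟩
      n G * (D * D)              ∎
      where
      rearrange : ∀ p q → p * (q * 1) ≡ q * p
      rearrange = solve-∀

    -- There are a_i(x) walks arriving at the edge xy and a_{ℓ-1-i}(y) leaving it, which are exactly
    -- the two denominators. What remains is a_{ℓ-i}(x) a_{i+1}(y); summed over y it is a_{ℓ-i}(x)
    -- a_{i+2}(x), and this sums to w_{ℓ+2}.
    inner-mass : ∀ i → i < ℓ → sum (W ℓ (X (2 + i))) ≤ D * D * w (2 + ℓ)
    inner-mass i (s≤s i≤L) = begin
      sum (W ℓ (X (2 + i)))                ≡⟨ cong (λ e → sum (W e (X (2 + i)))) i+ ⟨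
      sum (W (i + suc (L ∸ i)) (X (2 + i))) ≡⟨ W-edge i (L ∸ i) f ⟩
      sum (λ x → a i x * sum (λ y → A x y * (f x y * a (L ∸ i) y)))
        ≤⟨ sum-mono (λ x → *-monoʳ-≤ (a i x) (sum-mono (λ y → *-monoʳ-≤ (A x y) (cancel-y x y)))) ⟩
      sum (λ x → a i x * sum (λ y → A x y * (D * a p x * b i x * a (suc i) y)))
        ≡⟨ sum-cong-≗ (λ x → cong (a i x *_) (trans
             (sum-cong-≗ (λ y → x∙yz≈y∙xz (A x y) (D * a p x * b i x) (a (suc i) y)))
             (sym (*-distribˡ-sum (D * a p x * b i x) (λ y → A x y * a (suc i) y))))) ⟩
      sum (λ x → a i x * (D * a p x * b i x * a (2 + i) x))
        ≤⟨ sum-mono cancel-x ⟩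
      sum (λ x → D * D * (a p x * a (2 + i) x)) ≡⟨ *-distribˡ-sum (D * D) (λ x → a p x * a (2 + i) x) ⟨
      D * D * sum (λ x → a p x * a (2 + i) x)   ≡⟨ cong (D * D *_) (a-inner p (2 + i)) ⟩
      D * D * w (p + (2 + i))                   ≡⟨ cong (λ e → D * D * w e) p+ ⟩
      D * D * w (2 + ℓ)                         ∎
      where
      p = ℓ ∸ i
      f : V → V → ℕ
      f x y = a p x * b (L ∸ i) y * (b i x * a (suc i) y)
      i+ : i + suc (L ∸ i) ≡ ℓ
      i+ = trans (+-suc i (L ∸ i)) (cong suc (m+[n∸m]≡n i≤L))
      p+ : p + (2 + i) ≡ 2 + ℓ
      p+ = trans (rearrange p i) (cong (2 +_) (m∸n+n≡m (m≤n⇒m≤1+n i≤L)))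
        where
        rearrange : ∀ p i → p + (2 + i) ≡ 2 + (p + i)
        rearrange = solve-∀
      cancel-y : ∀ x y → f x y * a (L ∸ i) y ≤ D * a p x * b i x * a (suc i) y
      cancel-y x y = begin
        f x y * a (L ∸ i) y ≡⟨ rearrange (a p x) (b (L ∸ i) y) (b i x) (a (suc i) y) (a (L ∸ i) y) ⟩
        b (L ∸ i) y * a (L ∸ i) y * (a p x * (b i x * a (suc i) y))
          ≤⟨ *-monoˡ-≤ (a p x * (b i x * a (suc i) y)) (b*a≤D (L ∸ i) y) ⟩
        D * (a p x * (b i x * a (suc i) y)) ≡⟨ rearrange′ D (a p x) (b i x) (a (suc i) y) ⟩
        D * a p x * b i x * a (suc i) y ∎
        where
        rearrange : ∀ u v s t r → u * v * (s * t) * r ≡ v * r * (u * (s * t))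
        rearrange = solve-∀
        rearrange′ : ∀ d u s t → d * (u * (s * t)) ≡ d * u * s * t
        rearrange′ = solve-∀
      cancel-x : ∀ x → a i x * (D * a p x * b i x * a (2 + i) x) ≤ D * D * (a p x * a (2 + i) x)
      cancel-x x = begin
        a i x * (D * a p x * b i x * a (2 + i) x) ≡⟨ rearrange (a i x) D (a p x) (b i x) (a (2 + i) x) ⟩
        D * (b i x * a i x) * (a p x * a (2 + i) x)
          ≤⟨ *-monoˡ-≤ (a p x * a (2 + i) x) (*-monoʳ-≤ D (b*a≤D i x)) ⟩
        D * D * (a p x * a (2 + i) x) ∎
        where
        rearrange : ∀ u d p s t → u * (d * p * s * t) ≡ d * (s * u) * (p * t)
        rearrange = solve-∀

    insert-two-steps : w ℓ ^ (2 + ℓ) ≤ n G ^ 2 * w (2 + ℓ) ^ ℓ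
    insert-two-steps = *-cancelˡ-≤ ((D * D) ^ (2 + ℓ)) {{m^n≢0 (D * D) (2 + ℓ) {{>-nonZero (*-mono-≤ D>0 D>0)}}}} (begin
      (D * D) ^ (2 + ℓ) * w ℓ ^ (2 + ℓ)  ≡⟨ ^-distribʳ-* (D * D) (w ℓ) (2 + ℓ) ⟨
      (D * D * w ℓ) ^ (2 + ℓ)            ≡⟨ cong (_^ (2 + ℓ)) total ⟨
      sum (W ℓ (λ _ → D * D)) ^ (2 + ℓ)
        ≤⟨ hölder-walks (2 + ℓ) ℓ (λ _ → D * D) X (λ v s → ≤-reflexive (sym (product≡ v s))) ⟩
      sum (W ℓ (X 0)) * (sum (W ℓ (X 1)) * ∏ ℓ (λ i → sum (W ℓ (X (2 + i)))))
        ≤⟨ *-mono-≤ start-mass (*-mono-≤ end-mass (≤-trans (∏-mono ℓ inner-mass) (≤-reflexive (∏-const ℓ (D * D * w (2 + ℓ)))))) ⟩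
      n G * (D * D) * (n G * (D * D) * (D * D * w (2 + ℓ)) ^ ℓ)
        ≡⟨ cong (λ z → n G * (D * D) * (n G * (D * D) * z)) (^-distribʳ-* (D * D) (w (2 + ℓ)) ℓ) ⟩
      n G * (D * D) * (n G * (D * D) * ((D * D) ^ ℓ * w (2 + ℓ) ^ ℓ))
        ≡⟨ rearrange (n G) (D * D) ((D * D) ^ ℓ) (w (2 + ℓ) ^ ℓ) ⟩
      (D * D) ^ (2 + ℓ) * (n G ^ 2 * w (2 + ℓ) ^ ℓ) ∎)
      where
      rearrange : ∀ m d e u → m * d * (m * d * (e * u)) ≡ d * (d * e) * (m * (m * 1) * u)
      rearrange = solve-∀
      total : sum (W ℓ (λ _ → D * D)) ≡ D * D * w ℓ
      total = trans (sum-cong-≗ (W-head ℓ (λ _ → D * D))) (sym (*-distribˡ-sum (D * D) (a ℓ)))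

  -- Over ordered edges xy, a_m(x) a_m(y) sums to w_{2m+1}, while `K` = w_{2m} is the sum of the
  -- squares a_m(x)². Up to the scale D, `both` has mass at most K², and each of the 2m functions
  -- `left` and `right` has mass at most K.
  module AddOneStep (m : ℕ) where

    open Denominator m

    left right both : ℕ → V → V → ℕ
    left  j x y = a m x * a m x * (b (suc j) x * a j y)
    right j x y = left j y x
    both  _ x y = D * (a m x * a m x * (a m y * a m y))

    X : ℕ → V → V → ℕ
    X zero    = both 0
    X (suc j) = interleave left right j

    telescope : ∀ x → (∀ j → a j x > 0) → ∏ m (λ j → a j x * b (suc j) x) * a m x ≡ D ^ m
    telescope x pos = *-cancelʳ-≡ _ _ D {{>-nonZero D>0}} (begin-equality
      Π′ * a m x * D       ≡⟨ rearrange Π′ (a m x) D ⟩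
      Π′ * D * a m x       ≡⟨ cong (λ d → Π′ * d * a m x) b₀ ⟨
      Π′ * b 0 x * a m x   ≡⟨ cong (_* a m x) (∏-telescope m D (λ j → a j x) (λ j → b j x) (λ j j≤m → a*b j x j≤m (pos j))) ⟩
      D ^ m * b m x * a m x ≡⟨ *-assoc (D ^ m) (b m x) (a m x) ⟩
      D ^ m * (b m x * a m x) ≡⟨ cong (D ^ m *_) (trans (*-comm (b m x) _) (a*b m x ≤-refl (pos m))) ⟩
      D ^ m * D ∎)
      where
      Π′ = ∏ m (λ j → a j x * b (suc j) x)
      rearrange : ∀ p q r → p * q * r ≡ p * r * q
      rearrange = solve-∀
      b₀ : b 0 x ≡ D
      b₀ = trans (sym (*-identityˡ _)) (a*b 0 x z≤n (s≤s z≤n))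

    -- The 2m + 1 functions contain a_m(x) a_m(y) to the power 2m + 2. In each quotient numerator
    -- and denominator belong to different ends; after regrouping by ends, both products telescope
    -- to 1 / a_m and remove one power.
    product≡ : ∀ x y → (∀ j → a j x > 0) → (∀ j → a j y > 0) →
      ∏ (suc (m * 2)) (λ j → X j x y) ≡ (D * (a m x * a m y)) ^ suc (m * 2)
    product≡ x y px py = begin-equality
      D * (α * α * (β * β)) * ∏ (m * 2) (λ j → interleave left right j x y)
        ≡⟨ cong (D * (α * α * (β * β)) *_) (trans (∏-interleave (λ f → f x y) m left right)
             (trans (∏-cong m (λ j _ → regroup α β (b (suc j) x) (a j y) (b (suc j) y) (a j x)))
             (trans (∏-distrib-* m (λ _ → α * β * (α * β)) (λ j → a j x * b (suc j) x * (a j y * b (suc j) y)))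
             (cong₂ _*_ (∏-const m (α * β * (α * β))) (∏-distrib-* m (λ j → a j x * b (suc j) x) (λ j → a j y * b (suc j) y)))))) ⟩
      D * (α * α * (β * β)) * ((α * β * (α * β)) ^ m * (Πx * Πy))
        ≡⟨ rearrange D α β ((α * β * (α * β)) ^ m) Πx Πy ⟩
      D * (α * β) * ((α * β * (α * β)) ^ m * (Πx * α * (Πy * β)))
        ≡⟨ cong₂ (λ p q → D * (α * β) * ((α * β * (α * β)) ^ m * (p * q))) (telescope x px) (telescope y py) ⟩
      D * (α * β) * ((α * β * (α * β)) ^ m * (D ^ m * D ^ m))
        ≡⟨ cong (D * (α * β) *_) powers ⟩
      D * (α * β) * (D * (α * β)) ^ (m * 2) ∎
      where
      α = a m x
      β = a m y
      Πx = ∏ m (λ j → a j x * b (suc j) x)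
      Πy = ∏ m (λ j → a j y * b (suc j) y)
      regroup : ∀ α β p q r s → α * α * (p * q) * (β * β * (r * s)) ≡ α * β * (α * β) * (s * p * (q * r))
      regroup = solve-∀
      rearrange : ∀ d α β e p q → d * (α * α * (β * β)) * (e * (p * q)) ≡ d * (α * β) * (e * (p * α * (q * β)))
      rearrange = solve-∀
      square : ∀ γ d → γ * γ * (d * d) ≡ d * γ * (d * γ * 1)
      square = solve-∀
      powers : (α * β * (α * β)) ^ m * (D ^ m * D ^ m) ≡ (D * (α * β)) ^ (m * 2)
      powers = begin-equality
        (α * β * (α * β)) ^ m * (D ^ m * D ^ m) ≡⟨ cong ((α * β * (α * β)) ^ m *_) (^-distribʳ-* D D m) ⟨
        (α * β * (α * β)) ^ m * (D * D) ^ m     ≡⟨ ^-distribʳ-* (α * β * (α * β)) (D * D) m ⟨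
        (α * β * (α * β) * (D * D)) ^ m         ≡⟨ cong (_^ m) (square (α * β) D) ⟩
        ((D * (α * β)) ^ 2) ^ m                 ≡⟨ ^-*-assoc (D * (α * β)) 2 m ⟩
        (D * (α * β)) ^ (2 * m)                 ≡⟨ cong ((D * (α * β)) ^_) (*-comm 2 m) ⟩
        (D * (α * β)) ^ (m * 2)                 ∎

    mass : (V → V → ℕ) → ℕ
    mass f = sum (λ x → sum (λ y → A x y * f x y))

    W-mass : ∀ f → sum (W 1 (λ v → f (v 0) (v 1))) ≡ mass f
    W-mass f = trans (W-edge 0 0 f) (sum-cong-≗ (λ x → trans (+-identityʳ _) (sum-cong-≗ (λ y → cong (A x y *_) (*-identityʳ (f x y))))))

    K = w (m * 2)

    a²-mass : sum (λ x → a m x * a m x) ≡ K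
    a²-mass = trans (a-inner m m) (cong w (m+m≡m*2 m))

    both-mass : mass (both 0) ≤ D * (K * K)
    both-mass = begin
      mass (both 0) ≤⟨ sum-mono (λ x → sum-mono (λ y → ≤-trans (*-monoˡ-≤ (both 0 x y) (𝟙≤1 (adj G x y))) (≤-reflexive (+-identityʳ _)))) ⟩
      sum (λ x → sum (λ y → D * (a m x * a m x * (a m y * a m y))))
        ≡⟨ sum-cong-≗ (λ x → trans (sum-cong-≗ (λ y → sym (*-assoc D (a m x * a m x) (a m y * a m y))))
             (sym (*-distribˡ-sum (D * (a m x * a m x)) (λ y → a m y * a m y)))) ⟩
      sum (λ x → D * (a m x * a m x) * sum (λ y → a m y * a m y))
        ≡⟨ *-distribʳ-sum (sum (λ y → a m y * a m y)) (λ x → D * (a m x * a m x)) ⟨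
      sum (λ x → D * (a m x * a m x)) * sum (λ y → a m y * a m y)
        ≡⟨ cong (_* sum (λ y → a m y * a m y)) (*-distribˡ-sum D (λ x → a m x * a m x)) ⟨
      D * sum (λ x → a m x * a m x) * sum (λ y → a m y * a m y)
        ≡⟨ cong₂ (λ p q → D * p * q) a²-mass a²-mass ⟩
      D * K * K ≡⟨ *-assoc D K K ⟩
      D * (K * K) ∎

    -- Summing a_j(y) over the neighbours y of x gives a_{j+1}(x), the denominator.
    left-mass : ∀ j → mass (left j) ≤ D * K
    left-mass j = begin
      sum (λ x → sum (λ y → A x y * left j x y))
        ≡⟨ sum-cong-≗ (λ x → trans (sum-cong-≗ (λ y → rearrange (A x y) (a m x * a m x) (b (suc j) x) (a j y)))
             (sym (*-distribˡ-sum (a m x * a m x * b (suc j) x) (λ y → A x y * a j y)))) ⟩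
      sum (λ x → a m x * a m x * b (suc j) x * a (suc j) x)
        ≤⟨ sum-mono (λ x → ≤-trans (≤-reflexive (*-assoc (a m x * a m x) (b (suc j) x) (a (suc j) x)))
             (*-monoʳ-≤ (a m x * a m x) (b*a≤D (suc j) x))) ⟩
      sum (λ x → a m x * a m x * D) ≡⟨ *-distribʳ-sum D (λ x → a m x * a m x) ⟨
      sum (λ x → a m x * a m x) * D ≡⟨ cong (_* D) a²-mass ⟩
      K * D                         ≡⟨ *-comm K D ⟩
      D * K                         ∎
      where
      rearrange : ∀ s t p q → s * (t * (p * q)) ≡ t * p * (s * q)
      rearrange = solve-∀

    right-mass : ∀ j → mass (right j) ≤ D * K
    right-mass j = ≤-trans (≤-reflexive (trans (∑-comm (λ x y → A x y * left j y x))
      (sum-cong-≗ (λ y → sum-cong-≗ (λ x → cong (_* left j y x) (A-sym x y)))))) (left-mass j)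

    add-one-step : w (suc (m * 2)) ^ suc (m * 2) ≤ K ^ (2 + m * 2)
    add-one-step = *-cancelˡ-≤ (D ^ suc (m * 2)) {{m^n≢0 D (suc (m * 2)) {{>-nonZero D>0}}}} (begin
      D ^ suc (m * 2) * w (suc (m * 2)) ^ suc (m * 2) ≡⟨ ^-distribʳ-* D (w (suc (m * 2))) (suc (m * 2)) ⟨
      (D * w (suc (m * 2))) ^ suc (m * 2)             ≡⟨ cong (_^ suc (m * 2)) total ⟨
      sum (W 1 (λ v → D * (a m (v 0) * a m (v 1)))) ^ suc (m * 2)
        ≤⟨ hölder-walks (suc (m * 2)) 1 (λ v → D * (a m (v 0) * a m (v 1))) (λ j v → X j (v 0) (v 1)) (λ v s → ≤-reflexive (sym
             (product≡ (v 0) (v 1) (steps-pos 0 v s 0 z≤n) (steps-pos 0 v s 1 ≤-refl)))) ⟩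
      sum (W 1 (λ v → both 0 (v 0) (v 1))) * ∏ (m * 2) (λ j → sum (W 1 (λ v → interleave left right j (v 0) (v 1))))
        ≡⟨ cong₂ _*_ (W-mass (both 0)) (trans (∏-cong (m * 2) (λ j _ → W-mass (interleave left right j))) (∏-interleave mass m left right)) ⟩
      mass (both 0) * ∏ m (λ j → mass (left j) * mass (right j))
        ≤⟨ *-mono-≤ both-mass (≤-trans (∏-mono m (λ j _ → *-mono-≤ (left-mass j) (right-mass j))) (≤-reflexive (∏-const m (D * K * (D * K))))) ⟩
      D * (K * K) * (D * K * (D * K)) ^ m
        ≡⟨ cong (D * (K * K) *_) powers ⟩
      D * (K * K) * (D ^ (m * 2) * K ^ (m * 2))
        ≡⟨ rearrange D K (D ^ (m * 2)) (K ^ (m * 2)) ⟩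
      D ^ suc (m * 2) * K ^ (2 + m * 2) ∎)
      where
      rearrange : ∀ d k p q → d * (k * k) * (p * q) ≡ d * p * (k * (k * q))
      rearrange = solve-∀
      square : ∀ e → e * e ≡ e * (e * 1)
      square = solve-∀
      powers : (D * K * (D * K)) ^ m ≡ D ^ (m * 2) * K ^ (m * 2)
      powers = begin-equality
        (D * K * (D * K)) ^ m ≡⟨ cong (_^ m) (square (D * K)) ⟩
        ((D * K) ^ 2) ^ m     ≡⟨ ^-*-assoc (D * K) 2 m ⟩
        (D * K) ^ (2 * m)     ≡⟨ cong ((D * K) ^_) (*-comm 2 m) ⟩
        (D * K) ^ (m * 2)     ≡⟨ ^-distribʳ-* D K (m * 2) ⟩
        D ^ (m * 2) * K ^ (m * 2) ∎
      total : sum (W 1 (λ v → D * (a m (v 0) * a m (v 1)))) ≡ D * w (suc (m * 2))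
      total = begin-equality
        sum (W 1 (λ v → D * (a m (v 0) * a m (v 1)))) ≡⟨ W-mass (λ x y → D * (a m x * a m y)) ⟩
        sum (λ x → sum (λ y → A x y * (D * (a m x * a m y))))
          ≡⟨ sum-cong-≗ (λ x → trans (sum-cong-≗ (λ y → regroup (A x y) D (a m x) (a m y)))
               (sym (*-distribˡ-sum (D * a m x) (λ y → A x y * a m y)))) ⟩
        sum (λ x → D * a m x * a (suc m) x) ≡⟨ sum-cong-≗ (λ x → *-assoc D (a m x) (a (suc m) x)) ⟩
        sum (λ x → D * (a m x * a (suc m) x)) ≡⟨ *-distribˡ-sum D (λ x → a m x * a (suc m) x) ⟨
        D * sum (λ x → a m x * a (suc m) x) ≡⟨ cong (D *_) (a-inner m (suc m)) ⟩
        D * w (m + suc m) ≡⟨ cong (λ e → D * w e) (trans (+-suc m m) (cong suc (m+m≡m*2 m))) ⟩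
        D * w (suc (m * 2)) ∎
        where
        regroup : ∀ s d p q → s * (d * (p * q)) ≡ d * p * (s * q)
        regroup = solve-∀

-- Inequalities between path counts

compose : ∀ c x y z p q r s e f → x ^ p ≤ c ^ e * y ^ q → y ^ r ≤ c ^ f * z ^ s →
  x ^ (p * r) ≤ c ^ (e * r + f * q) * z ^ (s * q)
compose c x y z p q r s e f hxy hyz = begin
  x ^ (p * r)                       ≡⟨ ^-*-assoc x p r ⟨
  (x ^ p) ^ r                       ≤⟨ ^-monoˡ-≤ r hxy ⟩
  (c ^ e * y ^ q) ^ r               ≡⟨ ^-distribʳ-* (c ^ e) (y ^ q) r ⟩
  (c ^ e) ^ r * (y ^ q) ^ r         ≡⟨ cong₂ _*_ (^-*-assoc c e r) (^-swap y q r) ⟩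
  c ^ (e * r) * (y ^ r) ^ q         ≤⟨ *-monoʳ-≤ (c ^ (e * r)) (^-monoˡ-≤ q hyz) ⟩
  c ^ (e * r) * (c ^ f * z ^ s) ^ q ≡⟨ cong (c ^ (e * r) *_) (^-distribʳ-* (c ^ f) (z ^ s) q) ⟩
  c ^ (e * r) * ((c ^ f) ^ q * (z ^ s) ^ q)
    ≡⟨ cong₂ (λ u v → c ^ (e * r) * (u * v)) (^-*-assoc c f q) (^-*-assoc z s q) ⟩
  c ^ (e * r) * (c ^ (f * q) * z ^ (s * q)) ≡⟨ *-assoc (c ^ (e * r)) _ _ ⟨
  c ^ (e * r) * c ^ (f * q) * z ^ (s * q)   ≡⟨ cong (_* z ^ (s * q)) (^-distribˡ-+-* c (e * r) (f * q)) ⟨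
  c ^ (e * r + f * q) * z ^ (s * q)         ∎

take-root : ∀ c x z g .{{_ : NonZero g}} p e s → x ^ (p * g) ≤ c ^ (e * g) * z ^ (s * g) → x ^ p ≤ c ^ e * z ^ s
take-root c x z g p e s h = ^-cancelˡ-≤ g (begin
  (x ^ p) ^ g               ≡⟨ ^-*-assoc x p g ⟩
  x ^ (p * g)               ≤⟨ h ⟩
  c ^ (e * g) * z ^ (s * g) ≡⟨ cong₂ _*_ (^-*-assoc c e g) (^-*-assoc z s g) ⟨
  (c ^ e) ^ g * (z ^ s) ^ g ≡⟨ ^-distribʳ-* (c ^ e) (z ^ s) g ⟨
  (c ^ e * z ^ s) ^ g       ∎)

-- Eliminating y multiplies all exponents; g is their common factor, removed by a root.
compose-root : ∀ c x y z g .{{_ : NonZero g}} P E S p q r s e f →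
  x ^ p ≤ c ^ e * y ^ q → y ^ r ≤ c ^ f * z ^ s →
  p * r ≡ P * g → e * r + f * q ≡ E * g → s * q ≡ S * g → x ^ P ≤ c ^ E * z ^ S
compose-root c x y z g P E S p q r s e f hxy hyz pP eE sS = take-root c x z g P E S
  (subst₂ (λ u v → u ≤ v) (cong (x ^_) pP) (cong₂ (λ i j → c ^ i * z ^ j) eE sS) (compose c x y z p q r s e f hxy hyz))

compose-pure : ∀ x y z g .{{_ : NonZero g}} q r → x ^ g ≤ y ^ q → y ^ r ≤ z ^ g →
  x ^ r ≤ z ^ q
compose-pure x y z g q r hxy hyz = ^-cancelˡ-≤ g (begin
  (x ^ r) ^ g ≡⟨ ^-swap x r g ⟩
  (x ^ g) ^ r ≤⟨ ^-monoˡ-≤ r hxy ⟩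
  (y ^ q) ^ r ≡⟨ ^-swap y q r ⟩
  (y ^ r) ^ q ≤⟨ ^-monoˡ-≤ q hyz ⟩
  (z ^ g) ^ q ≡⟨ ^-swap z g q ⟩
  (z ^ q) ^ g ∎)

-- The ratios c(i+1) / c(i) do not decrease. The induction applies to the shifted sequence and
-- cancels a power of c(1), the case c(1) = 0 being trivial.
log-convex : ∀ (c : ℕ → ℕ) → (∀ i → c (1 + i) ^ 2 ≤ c i * c (2 + i)) → ∀ j → c 1 ^ suc j ≤ c 0 ^ j * c (suc j)
log-convex c h zero    = ≤-reflexive (*-comm (c 1) 1)
log-convex c h (suc j) with c 1 in eq
... | zero      = z≤n
... | c₁@(suc _) = *-cancelʳ-≤ _ _ (c₁ ^ j) {{m^n≢0 c₁ j}} (begin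
  c₁ ^ (2 + j) * c₁ ^ j                   ≡⟨ rearrange₁ c₁ (c₁ ^ j) ⟩
  c₁ ^ 2 * (c₁ ^ j * c₁ ^ j)              ≡⟨ cong (c₁ ^ 2 *_) (^-distribʳ-* c₁ c₁ j) ⟨
  c₁ ^ 2 * (c₁ * c₁) ^ j                  ≡⟨ cong (λ z → c₁ ^ 2 * (c₁ * z) ^ j) (*-identityʳ c₁) ⟨
  (c₁ ^ 2) ^ suc j                        ≤⟨ ^-monoˡ-≤ (suc j) (subst (λ z → z ^ 2 ≤ c 0 * c 2) eq (h 0)) ⟩
  (c 0 * c 2) ^ suc j                     ≡⟨ ^-distribʳ-* (c 0) (c 2) (suc j) ⟩
  c 0 ^ suc j * c 2 ^ suc j               ≤⟨ *-monoʳ-≤ (c 0 ^ suc j) (log-convex (c ∘ suc) (h ∘ suc) j) ⟩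
  c 0 ^ suc j * (c 1 ^ j * c (2 + j))     ≡⟨ cong (λ z → c 0 ^ suc j * (z ^ j * c (2 + j))) eq ⟩
  c 0 ^ suc j * (c₁ ^ j * c (2 + j))      ≡⟨ rearrange₂ (c 0 ^ suc j) (c₁ ^ j) (c (2 + j)) ⟩
  c 0 ^ suc j * c (2 + j) * c₁ ^ j        ∎)
  where
  rearrange₁ : ∀ u p → u * (u * p) * p ≡ u * (u * 1) * (p * p)
  rearrange₁ = solve-∀
  rearrange₂ : ∀ u v z → u * (v * z) ≡ u * z * v
  rearrange₂ = solve-∀

module PathInequalities (G : Graph) where
  open Walks G
  open WalkSums G

  N = n G

  -- For ℓ > 0: (w_ℓ / n)^{1/ℓ} does not decrease when ℓ grows by 2. Composing two such bounds
  -- multiplies all exponents by the intermediate length k, whose root is then taken.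
  same-parity : ∀ ℓ j → w ℓ ^ (ℓ + j * 2) ≤ N ^ (j * 2) * w (ℓ + j * 2) ^ ℓ
  same-parity zero      j = ≤-reflexive (trans (cong (_^ (j * 2)) w-zero) (sym (*-identityʳ _)))
  same-parity ℓ@(suc _) zero = ≤-reflexive (trans (cong (w ℓ ^_) (+-identityʳ ℓ))
    (trans (cong (λ e → w e ^ ℓ) (sym (+-identityʳ ℓ))) (sym (*-identityˡ _))))
  same-parity ℓ@(suc L) (suc j) = subst (λ e → w ℓ ^ e ≤ N ^ (2 + j * 2) * w e ^ ℓ) (shift ℓ (j * 2))
    (compose-root N (w ℓ) (w k) (w (2 + k)) k (2 + k) (2 + j * 2) ℓ k ℓ (2 + k) k (j * 2) 2
      (same-parity ℓ j) (InsertTwoSteps.insert-two-steps (L + j * 2))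
      (*-comm k (2 + k)) (exponent ℓ (j * 2)) (*-comm k ℓ))
    where
    k = ℓ + j * 2
    shift : ∀ ℓ e → 2 + (ℓ + e) ≡ ℓ + (2 + e)
    shift = solve-∀
    exponent : ∀ ℓ e → e * (2 + (ℓ + e)) + 2 * ℓ ≡ (2 + e) * (ℓ + e)
    exponent = solve-∀

  -- Cauchy-Schwarz bounds an odd count by its two even neighbours; the lower one is then replaced
  -- by the upper one through `same-parity`. For even lengths the neighbours would be odd, out of
  -- reach of this form of Cauchy-Schwarz.
  odd-to-next : ∀ j → w (1 + j * 2) ^ (2 + j * 2) ≤ N * w (2 + j * 2) ^ (1 + j * 2)
  odd-to-next j = ^-cancelˡ-≤ 2 (begin
    (w ℓ ^ (2 + i)) ^ 2                 ≡⟨ ^-swap (w ℓ) (2 + i) 2 ⟩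
    (w ℓ ^ 2) ^ (2 + i)                 ≤⟨ ^-monoˡ-≤ (2 + i) cauchy ⟩
    (w i * w (2 + i)) ^ (2 + i)         ≡⟨ ^-distribʳ-* (w i) (w (2 + i)) (2 + i) ⟩
    w i ^ (2 + i) * w (2 + i) ^ (2 + i) ≤⟨ *-monoˡ-≤ (w (2 + i) ^ (2 + i)) two-steps ⟩
    N ^ 2 * w (2 + i) ^ i * w (2 + i) ^ (2 + i) ≡⟨ square N (w (2 + i)) (w (2 + i) ^ i) ⟩
    (N * w (2 + i) ^ (1 + i)) ^ 2       ∎)
    where
    i = j * 2
    ℓ = 1 + i
    index : ∀ j → j + (1 + j) ≡ 1 + j * 2
    index = solve-∀
    index′ : ∀ j → 1 + j + (1 + j) ≡ 2 + j * 2
    index′ = solve-∀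
    cauchy : w ℓ ^ 2 ≤ w i * w (2 + i)
    cauchy = subst₂ _≤_ (cong (λ e → w e ^ 2) (index j)) (cong₂ (λ e f → w e * w f) (m+m≡m*2 j) (index′ j)) (w-cauchy j (1 + j))
    two-steps : w i ^ (2 + i) ≤ N ^ 2 * w (2 + i) ^ i
    two-steps = subst (λ e → w i ^ e ≤ N ^ 2 * w e ^ i) (+-comm i 2) (same-parity i 1)
    square : ∀ m u v → m * (m * 1) * v * (u * (u * v)) ≡ m * (u * v) * (m * (u * v) * 1)
    square = solve-∀

  odd-to-even : ∀ j i → let ℓ = 1 + j * 2 ; e = 1 + i * 2 in w ℓ ^ (ℓ + e) ≤ N ^ e * w (ℓ + e) ^ ℓ
  odd-to-even j i = subst (λ k → w ℓ ^ k ≤ N ^ (1 + i * 2) * w k ^ ℓ) (sym (+-suc ℓ (i * 2)))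
    (compose-root N (w ℓ) (w (1 + ℓ)) (w k) (1 + ℓ) k (1 + i * 2) ℓ (1 + ℓ) ℓ k (1 + ℓ) 1 (i * 2)
      (subst (λ z → w ℓ ^ (1 + ℓ) ≤ z * w (1 + ℓ) ^ ℓ) (sym (^-identityʳ N)) (odd-to-next j)) (same-parity (1 + ℓ) i)
      (*-comm (1 + ℓ) k) (exponent ℓ (i * 2)) (*-comm (1 + ℓ) ℓ))
    where
    ℓ = 1 + j * 2
    k = 1 + ℓ + i * 2
    exponent : ∀ ℓ e → 1 * (1 + ℓ + e) + e * ℓ ≡ (1 + e) * (1 + ℓ)
    exponent = solve-∀

  -- The remainder r has the parity of k + 1, so w_r is compared with w_{k+1}, and dropping one step
  -- to w_k costs a factor n. Each further block of k + 1 vertices is cut off and contributes one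
  -- factor w_k.
  even-by-odd : ∀ k r j → r + j * 2 ≡ suc k → ∀ c →
    w (r + c * suc k) ^ suc k ≤ N ^ suc k * w k ^ (r + c * suc k)
  even-by-odd k r j eq zero = subst (λ e → w e ^ suc k ≤ N ^ suc k * w k ^ e) (sym (+-identityʳ r)) (begin
    w r ^ suc k                        ≡⟨ cong (w r ^_) eq ⟨
    w r ^ (r + j * 2)                  ≤⟨ same-parity r j ⟩
    N ^ (j * 2) * w (r + j * 2) ^ r    ≡⟨ cong (λ e → N ^ (j * 2) * w e ^ r) eq ⟩
    N ^ (j * 2) * w (suc k) ^ r        ≤⟨ *-monoʳ-≤ (N ^ (j * 2)) (^-monoˡ-≤ r (w-step k)) ⟩
    N ^ (j * 2) * (N * w k) ^ r        ≡⟨ cong (N ^ (j * 2) *_) (^-distribʳ-* N (w k) r) ⟩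
    N ^ (j * 2) * (N ^ r * w k ^ r)    ≡⟨ *-assoc (N ^ (j * 2)) _ _ ⟨
    N ^ (j * 2) * N ^ r * w k ^ r      ≡⟨ cong (_* w k ^ r) (^-distribˡ-+-* N (j * 2) r) ⟨
    N ^ (j * 2 + r) * w k ^ r          ≡⟨ cong (λ e → N ^ e * w k ^ r) (trans (+-comm (j * 2) r) eq) ⟩
    N ^ suc k * w k ^ r                ∎)
  even-by-odd k r j eq (suc c) = subst (λ e → w e ^ suc k ≤ N ^ suc k * w k ^ e) (shift r (suc k) (c * suc k)) (begin
    w (ℓ + suc k) ^ suc k              ≤⟨ ^-monoˡ-≤ (suc k) (w-split ℓ k) ⟩
    (w ℓ * w k) ^ suc k                ≡⟨ ^-distribʳ-* (w ℓ) (w k) (suc k) ⟩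
    w ℓ ^ suc k * w k ^ suc k          ≤⟨ *-monoˡ-≤ (w k ^ suc k) (even-by-odd k r j eq c) ⟩
    N ^ suc k * w k ^ ℓ * w k ^ suc k  ≡⟨ *-assoc (N ^ suc k) _ _ ⟩
    N ^ suc k * (w k ^ ℓ * w k ^ suc k) ≡⟨ cong (N ^ suc k *_) (^-distribˡ-+-* (w k) ℓ (suc k)) ⟨
    N ^ suc k * w k ^ (ℓ + suc k)      ∎)
    where
    ℓ = r + c * suc k
    shift : ∀ r k e → r + e + k ≡ r + (k + e)
    shift = solve-∀

  -- With k = 2m, log-convexity along even lengths bounds w_{k+2} through w_k and the distant
  -- w_{2k+2}. That length is chosen because it can be cut into lengths k and k + 1, and
  -- `add-one-step` controls the latter by w_k.
  even-to-next-even : ∀ m → w (2 + m * 2) ^ (1 + m * 2) ≤ w (m * 2) ^ (3 + m * 2)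
  even-to-next-even m = ^-cancelˡ-≤ (suc m) (begin
    (w (2 + k) ^ (1 + k)) ^ suc m            ≡⟨ ^-swap (w (2 + k)) (1 + k) (suc m) ⟩
    (w (2 + k) ^ suc m) ^ (1 + k)            ≤⟨ ^-monoˡ-≤ (1 + k) convex ⟩
    (w k ^ suc m * w (1 + k)) ^ (1 + k)      ≡⟨ ^-distribʳ-* (w k ^ suc m) (w (1 + k)) (1 + k) ⟩
    (w k ^ suc m) ^ (1 + k) * w (1 + k) ^ (1 + k) ≤⟨ *-mono-≤ (≤-reflexive (^-*-assoc (w k) (suc m) (1 + k))) (AddOneStep.add-one-step m) ⟩
    w k ^ (suc m * (1 + k)) * w k ^ (2 + k)  ≡⟨ ^-distribˡ-+-* (w k) (suc m * (1 + k)) (2 + k) ⟨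
    w k ^ (suc m * (1 + k) + (2 + k))        ≡⟨ cong (w k ^_) (exponent m) ⟩
    w k ^ ((3 + k) * suc m)                  ≡⟨ ^-*-assoc (w k) (3 + k) (suc m) ⟨
    (w k ^ (3 + k)) ^ suc m                  ∎)
    where
    k = m * 2
    exponent : ∀ m → suc m * (1 + m * 2) + (2 + m * 2) ≡ (3 + m * 2) * suc m
    exponent = solve-∀
    even-convex : ∀ i → w ((1 + i + m) * 2) ^ 2 ≤ w ((i + m) * 2) * w ((2 + i + m) * 2)
    even-convex i = subst₂ _≤_ (cong (λ e → w e ^ 2) (index₁ i m)) (cong₂ (λ e f → w e * w f) (m+m≡m*2 (i + m)) (m+m≡m*2 (2 + i + m)))
      (w-cauchy (i + m) (2 + i + m))
      where
      index₁ : ∀ i m → i + m + (2 + i + m) ≡ (1 + i + m) * 2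
      index₁ = solve-∀
    index : ∀ m → (suc m + m) * 2 ≡ m * 2 + (1 + (1 + m * 2))
    index = solve-∀
    convex : w (2 + k) ^ suc m ≤ w k ^ suc m * w (1 + k)
    convex = begin
      w (2 + k) ^ suc m                ≤⟨ log-convex (λ i → w ((i + m) * 2)) even-convex m ⟩
      w k ^ m * w ((suc m + m) * 2)    ≡⟨ cong (λ e → w k ^ m * w e) (index m) ⟩
      w k ^ m * w (k + suc (1 + k))    ≤⟨ *-monoʳ-≤ (w k ^ m) (w-split k (1 + k)) ⟩
      w k ^ m * (w k * w (1 + k))      ≡⟨ rearrange (w k ^ m) (w k) (w (1 + k)) ⟩
      w k ^ suc m * w (1 + k)          ∎
      where
      rearrange : ∀ p u v → p * (u * v) ≡ u * p * v
      rearrange = solve-∀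

  -- Iteration: w_k^{1/(k+1)} does not increase along even k.
  even-to-even : ∀ m i → w ((i + m) * 2) ^ (1 + m * 2) ≤ w (m * 2) ^ (1 + (i + m) * 2)
  even-to-even m zero    = ≤-refl
  even-to-even m (suc i) = compose-pure (w ((suc i + m) * 2)) (w ((i + m) * 2)) (w (m * 2)) (1 + (i + m) * 2) (3 + (i + m) * 2) (1 + m * 2)
    (even-to-next-even (i + m)) (even-to-even m i)

  even-to-odd : ∀ m i → w (1 + (i + m) * 2) ^ (1 + m * 2) ≤ w (m * 2) ^ (2 + (i + m) * 2)
  even-to-odd m i = compose-pure (w (1 + (i + m) * 2)) (w ((i + m) * 2)) (w (m * 2)) (1 + (i + m) * 2) (2 + (i + m) * 2) (1 + m * 2)
    (AddOneStep.add-one-step (i + m)) (even-to-even m i)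

  w-blocks : ∀ k c → w (k + c * suc k) ≤ w k ^ suc c
  w-blocks k zero    = ≤-reflexive (trans (cong w (+-identityʳ k)) (sym (*-identityʳ (w k))))
  w-blocks k (suc c) = begin
    w (k + suc c * suc k)       ≡⟨ cong w (shift k (c * suc k)) ⟩
    w (k + c * suc k + suc k)   ≤⟨ w-split (k + c * suc k) k ⟩
    w (k + c * suc k) * w k     ≤⟨ *-monoˡ-≤ (w k) (w-blocks k c) ⟩
    w k ^ suc c * w k           ≡⟨ *-comm (w k ^ suc c) (w k) ⟩
    w k ^ suc (suc c)           ∎
    where
    shift : ∀ k e → k + (suc k + e) ≡ k + e + suc k
    shift = solve-∀

  -- The length ℓ + 2j is chosen so that its path has (c+1)(k+1) vertices: lengthening keeps the
  -- parity, and the longer path is cut into c + 1 copies of P_k.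
  odd-by-shorter-odd : ∀ k c ℓ j → ℓ + j * 2 ≡ k + c * suc k →
    w ℓ ^ (ℓ + j * 2) ≤ N ^ (j * 2) * w k ^ (suc c * ℓ)
  odd-by-shorter-odd k c ℓ j eq = begin
    w ℓ ^ (ℓ + j * 2)                    ≤⟨ same-parity ℓ j ⟩
    N ^ (j * 2) * w (ℓ + j * 2) ^ ℓ      ≡⟨ cong (λ e → N ^ (j * 2) * w e ^ ℓ) eq ⟩
    N ^ (j * 2) * w (k + c * suc k) ^ ℓ  ≤⟨ *-monoʳ-≤ (N ^ (j * 2)) (^-monoˡ-≤ ℓ (w-blocks k c)) ⟩
    N ^ (j * 2) * (w k ^ suc c) ^ ℓ      ≡⟨ cong (N ^ (j * 2) *_) (^-*-assoc (w k) (suc c) ℓ) ⟩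
    N ^ (j * 2) * w k ^ (suc c * ℓ)      ∎

-- Exponents of densities as inequalities between natural numbers

/-homo-* : ∀ x y b d .{{_ : NonZero b}} .{{_ : NonZero d}} .{{_ : NonZero (b * d)}} →
  ((ℤ.+ x) ℚᵘ./ b) ℚᵘ.* ((ℤ.+ y) ℚᵘ./ d) ℚᵘ.≃ (ℤ.+ (x * y)) ℚᵘ./ (b * d)
/-homo-* x y (suc b) (suc d) = *≡* (cong (ℤ._* ℤ.+ (suc b * suc d)) (sym (pos-* x y)))

toℚᵘ-^ᵣ : ∀ x d .{{_ : NonZero d}} e .{{_ : NonZero (d ^ e)}} →
  toℚᵘ (((ℤ.+ x) ℚ./ d) ^ᵣ e) ℚᵘ.≃ (ℤ.+ (x ^ e)) ℚᵘ./ (d ^ e)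
toℚᵘ-^ᵣ x d       zero    = ≃-refl
toℚᵘ-^ᵣ x (suc d) (suc e) = ≃-trans (toℚᵘ-homo-* ((ℤ.+ x) ℚ./ suc d) (((ℤ.+ x) ℚ./ suc d) ^ᵣ e))
  (≃-trans (ℚᵘₚ.*-cong (toℚᵘ-fromℚᵘ (ℚᵘ.mkℚᵘ (ℤ.+ x) d)) (toℚᵘ-^ᵣ x (suc d) e))
    (/-homo-* x (x ^ e) (suc d) (suc d ^ e)))
  where instance _ = m^n≢0 (suc d) e

/-mono-≤ : ∀ {x y} b d .{{_ : NonZero b}} .{{_ : NonZero d}} → x * d ≤ y * b → (ℤ.+ x) ℚᵘ./ b ℚᵘ.≤ (ℤ.+ y) ℚᵘ./ d
/-mono-≤ {x} {y} (suc b) (suc d) h = *≤* (subst₂ ℤ._≤_ (pos-* x (suc d)) (pos-* y (suc b)) (ℤ.+≤+ h))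

/-cancel-≤ : ∀ {x y} b d .{{_ : NonZero b}} .{{_ : NonZero d}} → (ℤ.+ x) ℚᵘ./ b ℚᵘ.≤ (ℤ.+ y) ℚᵘ./ d → x * d ≤ y * b
/-cancel-≤ {x} {y} (suc b) (suc d) h =
  ℤₚ.drop‿+≤+ (subst₂ ℤ._≤_ (sym (pos-* x (suc d))) (sym (pos-* y (suc b))) (drop-*≤* h))

module Density (T : Target) where
  open Walks (graph T)
  open PathHom (graph T)

  N = n (graph T)

  instance
    N-nonZero : NonZero N
    N-nonZero = nonempty T

  density-^ : ∀ m e .{{_ : NonZero ((N ^ suc m) ^ e)}} →
    toℚᵘ (t (P m) T ^ᵣ e) ℚᵘ.≃ (ℤ.+ (w m ^ e)) ℚᵘ./ ((N ^ suc m) ^ e)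
  density-^ m e = subst (λ h → toℚᵘ (t (P m) T ^ᵣ e) ℚᵘ.≃ (ℤ.+ (h ^ e)) ℚᵘ./ ((N ^ suc m) ^ e)) (hom≡w m)
    (toℚᵘ-^ᵣ (hom (P m) (graph T)) (N ^ suc m) {{m^n≢0 N (suc m)}} e)

  module _ (k ℓ p q : ℕ) where
    private instance
      _ = m^n≢0 (N ^ suc ℓ) p {{m^n≢0 N (suc ℓ)}}
      _ = m^n≢0 (N ^ suc k) q {{m^n≢0 N (suc k)}}

    counts⇒densities : w ℓ ^ p * (N ^ suc k) ^ q ≤ w k ^ q * (N ^ suc ℓ) ^ p → t (P ℓ) T ^ᵣ p ℚ.≤ t (P k) T ^ᵣ q
    counts⇒densities h = toℚᵘ-cancel-≤ (≤-respˡ-≃ (≃-sym (density-^ ℓ p)) (≤-respʳ-≃ (≃-sym (density-^ k q))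
      (/-mono-≤ ((N ^ suc ℓ) ^ p) ((N ^ suc k) ^ q) h)))

    densities⇒counts : t (P ℓ) T ^ᵣ p ℚ.≤ t (P k) T ^ᵣ q → w ℓ ^ p * (N ^ suc k) ^ q ≤ w k ^ q * (N ^ suc ℓ) ^ p
    densities⇒counts h = /-cancel-≤ ((N ^ suc ℓ) ^ p) ((N ^ suc k) ^ q)
      (≤-respˡ-≃ (density-^ ℓ p) (≤-respʳ-≃ (density-^ k q) (toℚᵘ-mono-≤ h)))

-- The equation on e is homogeneity: after clearing denominators both sides carry the same power of
-- the number of vertices.
admissible : ∀ k ℓ p q e → (∀ G → let open Walks G in w ℓ ^ p ≤ n G ^ e * w k ^ q) →
  e + suc k * q ≡ suc ℓ * p → Admissible (P k) (P ℓ) p q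
admissible k ℓ p q e h eq T = counts⇒densities k ℓ p q (begin
  w ℓ ^ p * (N ^ suc k) ^ q         ≡⟨ cong (w ℓ ^ p *_) (^-*-assoc N (suc k) q) ⟩
  w ℓ ^ p * N ^ (suc k * q)         ≤⟨ *-monoˡ-≤ (N ^ (suc k * q)) (h (graph T)) ⟩
  N ^ e * w k ^ q * N ^ (suc k * q) ≡⟨ rearrange (N ^ e) (w k ^ q) (N ^ (suc k * q)) ⟩
  w k ^ q * (N ^ e * N ^ (suc k * q)) ≡⟨ cong (w k ^ q *_) (^-distribˡ-+-* N e (suc k * q)) ⟨
  w k ^ q * N ^ (e + suc k * q)     ≡⟨ cong (λ f → w k ^ q * N ^ f) eq ⟩
  w k ^ q * N ^ (suc ℓ * p)         ≡⟨ cong (w k ^ q *_) (^-*-assoc N (suc ℓ) p) ⟨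
  w k ^ q * (N ^ suc ℓ) ^ p         ∎)
  where
  open Walks (graph T)
  open Density T
  rearrange : ∀ u v z → u * v * z ≡ v * (u * z)
  rearrange = solve-∀

-- A family of targets with t(P_k) ≤ c B^{-x} and t(P_ℓ) ≥ c'^{-1} B^{-y}.
record Extremal (k ℓ x y : ℕ) : Set where
  field
    c c′    : ℕ
    target  : ∀ B .{{_ : NonZero B}} → Target
    k-upper : ∀ B .{{_ : NonZero B}} → let open Walks (graph (target B)) in w k * B ^ x ≤ c * n (graph (target B)) ^ suc k
    ℓ-lower : ∀ B .{{_ : NonZero B}} → let open Walks (graph (target B)) in n (graph (target B)) ^ suc ℓ ≤ c′ * B ^ y * w ℓ

-- An admissible p/q would give B^{xq} ≤ `bound` · B^{yp} for every B. As xq exceeds yp, this forces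
-- B ≤ `bound`, which fails for the next integer. The common factor can be cancelled because
-- `ℓ-lower` makes w_ℓ positive.
extremal⇒not-admissible : ∀ {k ℓ x y} → Extremal k ℓ x y → ∀ p q → p * y < x * q → ¬ Admissible (P k) (P ℓ) p q
extremal⇒not-admissible {k} {ℓ} {x} {y} E p q py<xq adm = <⇒≱ ≤-refl (*-cancelʳ-≤ B bound (B ^ (y * p)) {{m^n≢0 B (y * p)}} (begin
    B * B ^ (y * p)          ≤⟨ ^-monoʳ-≤ B (subst (λ e → suc e ≤ x * q) (*-comm p y) py<xq) ⟩
    B ^ (x * q)              ≤⟨ *-cancelˡ-≤ (w ℓ ^ p * (N ^ suc k) ^ q) {{factor≢0}} chain ⟩
    bound * B ^ (y * p)      ∎))
  where
  open Extremal E
  bound = c ^ q * c′ ^ p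
  B = suc bound
  open Walks (graph (target B))
  open Density (target B)
  wℓ>0 : w ℓ > 0
  wℓ>0 = n≢0⇒n>0 λ w≡0 → <⇒≱ (m^n>0 N (suc ℓ)) (≤-trans (ℓ-lower B) (≤-reflexive (trans (cong (c′ * B ^ y *_) w≡0) (*-zeroʳ (c′ * B ^ y)))))
  factor≢0 : NonZero (w ℓ ^ p * (N ^ suc k) ^ q)
  factor≢0 = m*n≢0 (w ℓ ^ p) _ {{m^n≢0 (w ℓ) p {{>-nonZero wℓ>0}}}} {{m^n≢0 (N ^ suc k) q {{m^n≢0 N (suc k)}}}}
  rearrange₁ : ∀ u v z → u * v * z ≡ u * z * v
  rearrange₁ = solve-∀
  rearrange₂ : ∀ u v s t r → u * v * (s * t * r) ≡ r * v * (u * s * t)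
  rearrange₂ = solve-∀
  chain : w ℓ ^ p * (N ^ suc k) ^ q * B ^ (x * q) ≤ w ℓ ^ p * (N ^ suc k) ^ q * (bound * B ^ (y * p))
  chain = begin
    w ℓ ^ p * (N ^ suc k) ^ q * B ^ (x * q)
      ≤⟨ *-monoˡ-≤ (B ^ (x * q)) (densities⇒counts k ℓ p q (adm (target B))) ⟩
    w k ^ q * (N ^ suc ℓ) ^ p * B ^ (x * q)    ≡⟨ rearrange₁ (w k ^ q) ((N ^ suc ℓ) ^ p) (B ^ (x * q)) ⟩
    w k ^ q * B ^ (x * q) * (N ^ suc ℓ) ^ p    ≡⟨ cong (λ z → w k ^ q * z * (N ^ suc ℓ) ^ p) (^-*-assoc B x q) ⟨
    w k ^ q * (B ^ x) ^ q * (N ^ suc ℓ) ^ p    ≡⟨ cong (_* (N ^ suc ℓ) ^ p) (^-distribʳ-* (w k) (B ^ x) q) ⟨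
    (w k * B ^ x) ^ q * (N ^ suc ℓ) ^ p
      ≤⟨ *-mono-≤ (^-monoˡ-≤ q (k-upper B)) (^-monoˡ-≤ p (ℓ-lower B)) ⟩
    (c * N ^ suc k) ^ q * (c′ * B ^ y * w ℓ) ^ p
      ≡⟨ cong₂ _*_ (^-distribʳ-* c (N ^ suc k) q) (trans (^-distribʳ-* (c′ * B ^ y) (w ℓ) p)
           (cong (_* w ℓ ^ p) (trans (^-distribʳ-* c′ (B ^ y) p) (cong (c′ ^ p *_) (^-*-assoc B y p))))) ⟩
    c ^ q * (N ^ suc k) ^ q * (c′ ^ p * B ^ (y * p) * w ℓ ^ p)
      ≡⟨ rearrange₂ (c ^ q) ((N ^ suc k) ^ q) (c′ ^ p) (B ^ (y * p)) (w ℓ ^ p) ⟩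
    w ℓ ^ p * (N ^ suc k) ^ q * (bound * B ^ (y * p)) ∎

-- Layered graphs

sum-split : ∀ m {k} (g : Fin (m + k) → ℕ) → sum g ≡ sum (λ i → g (i ↑ˡ k)) + sum (λ j → g (m ↑ʳ j))
sum-split zero    g = refl
sum-split (suc m) g = trans (cong (g zero +_) (sum-split m (g ∘ suc))) (sym (+-assoc (g zero) _ _))

sum-combine : ∀ m {k} (g : Fin (m * k) → ℕ) → sum g ≡ sum (λ i → sum (λ j → g (combine {m} {k} i j)))
sum-combine zero        g = refl
sum-combine (suc m) {k} g = trans (sum-split k g) (cong (sum (λ j → g (j ↑ˡ (m * k))) +_) (sum-combine m (λ i → g (k ↑ʳ i))))

≡ᵇ-comm : ∀ m n → (m ≡ᵇ n) ≡ (n ≡ᵇ m)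
≡ᵇ-comm zero    zero    = refl
≡ᵇ-comm zero    (suc n) = refl
≡ᵇ-comm (suc m) zero    = refl
≡ᵇ-comm (suc m) (suc n) = ≡ᵇ-comm m n

≡ᵇ-true⇒≡ : ∀ m n → (m ≡ᵇ n) ≡ true → m ≡ n
≡ᵇ-true⇒≡ zero    zero    _ = refl
≡ᵇ-true⇒≡ (suc m) (suc n) h = cong suc (≡ᵇ-true⇒≡ m n h)

suc≢ᵇ : ∀ m → (suc m ≡ᵇ m) ≡ false
suc≢ᵇ zero    = refl
suc≢ᵇ (suc m) = suc≢ᵇ m

count-zero : ∀ m → sum {m} (λ _ → 0) ≡ 0
count-zero m = trans (sum-const m 0) (*-zeroʳ m)

count-< : ∀ {m} c → c ≤ m → sum {m} (λ i → 𝟙 (toℕ i <ᵇ c)) ≡ c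
count-< {m}     zero    _       = count-zero m
count-< {suc m} (suc c) (s≤s p) = cong suc (count-< c p)

count-≡ : ∀ {m} c → c < m → sum {m} (λ i → 𝟙 (c ≡ᵇ toℕ i)) ≡ 1
count-≡ {suc m} zero    _       = cong suc (count-zero m)
count-≡ {suc m} (suc c) (s≤s p) = count-≡ c p

count-≡-≤1 : ∀ m c → sum {m} (λ i → 𝟙 (c ≡ᵇ toℕ i)) ≤ 1
count-≡-≤1 zero    c       = z≤n
count-≡-≤1 (suc m) zero    = s≤s (≤-reflexive (count-zero m))
count-≡-≤1 (suc m) (suc c) = count-≡-≤1 m c

𝟙-∨-≤ : ∀ b c → 𝟙 (b ∨ c) ≤ 𝟙 b + 𝟙 c
𝟙-∨-≤ true  c = s≤s z≤n
𝟙-∨-≤ false c = ≤-refl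

_~_ : ℕ → ℕ → Bool
p ~ q = (suc p ≡ᵇ q) ∨ (suc q ≡ᵇ p)

~-comm : ∀ p q → (p ~ q) ≡ (q ~ p)
~-comm p q = ∨-comm (suc p ≡ᵇ q) (suc q ≡ᵇ p)

~-irrefl : ∀ p → (p ~ p) ≡ false
~-irrefl p rewrite suc≢ᵇ p = refl

~-suc : ∀ p → (p ~ suc p) ≡ true
~-suc zero    = refl
~-suc (suc p) = ~-suc p

~-cases : ∀ p q → (p ~ q) ≡ true → (q ≡ suc p) ⊎ (p ≡ suc q)
~-cases p q h with suc p ≡ᵇ q in eq
... | true  = inj₁ (sym (≡ᵇ-true⇒≡ (suc p) q eq))
... | false = inj₂ (sym (≡ᵇ-true⇒≡ (suc q) p h))

-- A layer has at most two neighbouring layers; this is the 2 in the factor `2 * d` of the upper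
-- bounds.
count-~ : ∀ m p → sum {m} (λ i → 𝟙 (p ~ toℕ i)) ≤ 2
count-~ m p = begin
  sum {m} (λ i → 𝟙 (p ~ toℕ i)) ≤⟨ sum-mono {m} (λ i → 𝟙-∨-≤ (suc p ≡ᵇ toℕ i) (suc (toℕ i) ≡ᵇ p)) ⟩
  sum {m} (λ i → 𝟙 (suc p ≡ᵇ toℕ i) + 𝟙 (suc (toℕ i) ≡ᵇ p)) ≡⟨ sum-distrib-+ {m} (λ i → 𝟙 (suc p ≡ᵇ toℕ i)) (λ i → 𝟙 (suc (toℕ i) ≡ᵇ p)) ⟩
  sum {m} (λ i → 𝟙 (suc p ≡ᵇ toℕ i)) + sum {m} (λ i → 𝟙 (suc (toℕ i) ≡ᵇ p)) ≤⟨ +-mono-≤ (count-≡-≤1 m (suc p)) (below p) ⟩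
  2 ∎
  where
  below : ∀ p → sum {m} (λ i → 𝟙 (suc (toℕ i) ≡ᵇ p)) ≤ 1
  below zero    = ≤-trans (≤-reflexive (count-zero m)) z≤n
  below (suc p) = ≤-trans (≤-reflexive (sum-cong-≗ {m} (λ i → cong 𝟙 (≡ᵇ-comm (toℕ i) p)))) (count-≡-≤1 m p)

data LayerWalk (L : ℕ) : ℕ → ℕ → ℕ → Set where
  done : ∀ {p} → LayerWalk L p p 0
  step : ∀ {p q j m} → (p ~ q) ≡ true → q < L → LayerWalk L q j m → LayerWalk L p j (suc m)

-- Layer p has B^{2 + 2 h p} active vertices; consecutive layers p, q are joined completely, or,
-- at a junction, with density 1/B (same colour), so that every active vertex of layer p
-- has B^{δ + h q - h p} neighbours in layer q.
module Layered (L σ δ : ℕ) (h : ℕ → ℕ) (junction : ℕ → Bool)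
  (capacity : ∀ p → p < L → 1 + (h p + h p) ≤ σ)
  (balanced : ∀ p q → (p ~ q) ≡ true → p < L → q < L → suc (h p + h q + 𝟙 (not (junction (p ⊓ q)))) ≡ δ)
  (B : ℕ) .{{B≢0 : NonZero B}} where

  S d : ℕ
  S = B ^ σ
  d = B ^ δ

  -- `s p` is the square root of the number of active vertices in layer p; `ν p` counts their slots,
  -- each of which occurs in all B colours.
  s ν : ℕ → ℕ
  s p = B ^ suc (h p)
  ν p = B ^ (1 + (h p + h p))

  c : ℕ → ℕ → ℕ
  c p q = B ^ 𝟙 (not (junction (p ⊓ q)))

  s≢0 : ∀ p → NonZero (s p)
  s≢0 p = m^n≢0 B (suc (h p))

  ν*B : ∀ p → ν p * B ≡ s p * s p
  ν*B p = trans (cong (λ z → B * z * B) (^-distribˡ-+-* B (h p) (h p))) (rearrange B (B ^ h p))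
    where
    rearrange : ∀ b e → b * (e * e) * b ≡ b * e * (b * e)
    rearrange = solve-∀

  -- The number of neighbours in layer q is d s_q / s_p. Along a route these ratios telescope, which
  -- is why only the end layers enter the walk counts.
  degree : ∀ p q → (p ~ q) ≡ true → p < L → q < L → s p * (ν q * c p q) ≡ d * s q
  degree p q pq p<L q<L = begin-equality
    s p * (ν q * c p q)                              ≡⟨ cong (s p *_) (^-distribˡ-+-* B (1 + (h q + h q)) ε) ⟨
    s p * B ^ (1 + (h q + h q) + ε)                  ≡⟨ ^-distribˡ-+-* B (suc (h p)) (1 + (h q + h q) + ε) ⟨
    B ^ (suc (h p) + (1 + (h q + h q) + ε))          ≡⟨ cong (B ^_) (trans (rearrange (h p) (h q) ε) (cong (_+ suc (h q)) (balanced p q pq p<L q<L))) ⟩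
    B ^ (δ + suc (h q))                              ≡⟨ ^-distribˡ-+-* B δ (suc (h q)) ⟩
    d * s q                                          ∎
    where
    ε = 𝟙 (not (junction (p ⊓ q)))
    rearrange : ∀ x y e → suc x + (1 + (y + y) + e) ≡ suc (x + y + e) + suc y
    rearrange = solve-∀

  Vertex : Set
  Vertex = Fin (L * (S * B))

  vertex : Fin L → Fin S → Fin B → Vertex
  vertex p x y = combine p (combine x y)

  layer slot colour : Vertex → ℕ
  layer  v = toℕ (proj₁ (remQuot {L} (S * B) v))
  slot   v = toℕ (proj₁ (remQuot {S} B (proj₂ (remQuot {L} (S * B) v))))
  colour v = toℕ (proj₂ (remQuot {S} B (proj₂ (remQuot {L} (S * B) v))))

  layer-vertex : ∀ p x y → layer (vertex p x y) ≡ toℕ p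
  layer-vertex p x y = cong (toℕ ∘ proj₁) (remQuot-combine {L} {S * B} p (combine x y))

  slot-vertex : ∀ p x y → slot (vertex p x y) ≡ toℕ x
  slot-vertex p x y = trans (cong (λ r → toℕ (proj₁ (remQuot {S} B (proj₂ r)))) (remQuot-combine {L} {S * B} p (combine x y)))
    (cong (toℕ ∘ proj₁) (remQuot-combine {S} {B} x y))

  colour-vertex : ∀ p x y → colour (vertex p x y) ≡ toℕ y
  colour-vertex p x y = trans (cong (λ r → toℕ (proj₂ (remQuot {S} B (proj₂ r)))) (remQuot-combine {L} {S * B} p (combine x y)))
    (cong (toℕ ∘ proj₂) (remQuot-combine {S} {B} x y))

  layer<L : ∀ v → layer v < L
  layer<L v = toℕ<n (proj₁ (remQuot {L} (S * B) v))

  colour<B : ∀ v → colour v < B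
  colour<B v = toℕ<n (proj₂ (remQuot {S} B (proj₂ (remQuot {L} (S * B) v))))

  active : Vertex → Bool
  active v = slot v <ᵇ ν (layer v)

  match : ℕ → ℕ → ℕ → ℕ → Bool
  match p q y z = not (junction (p ⊓ q)) ∨ (y ≡ᵇ z)

  adjacent : Vertex → Vertex → Bool
  adjacent v v′ = (layer v ~ layer v′) ∧ ((active v ∧ active v′) ∧ match (layer v) (layer v′) (colour v) (colour v′))

  graphᴸ : Graph
  graphᴸ = record
    { n      = L * (S * B)
    ; adj    = adjacent
    ; sym    = λ v v′ → cong₂ _∧_ (~-comm (layer v) (layer v′)) (cong₂ _∧_ (∧-comm (active v) (active v′))
        (cong₂ _∨_ (cong (not ∘ junction) (⊓-comm (layer v) (layer v′))) (≡ᵇ-comm (colour v) (colour v′))))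
    ; irrefl = λ v → cong (_∧ ((active v ∧ active v) ∧ match (layer v) (layer v) (colour v) (colour v))) (~-irrefl (layer v))
    }

  open Walks graphᴸ

  sum-vertices : ∀ (f : Vertex → ℕ) → sum f ≡ sum (λ p → sum (λ x → sum (λ y → f (vertex p x y))))
  sum-vertices f = trans (sum-combine L f) (sum-cong-≗ {L} (λ p → sum-combine S (λ i → f (combine p i))))

  A-vertex : ∀ v p x y → A v (vertex p x y) ≡
    𝟙 (layer v ~ toℕ p) * (𝟙 (active v) * 𝟙 (toℕ x <ᵇ ν (toℕ p)) * 𝟙 (match (layer v) (toℕ p) (colour v) (toℕ y)))
  A-vertex v p x y rewrite layer-vertex p x y | slot-vertex p x y | colour-vertex p x y =
    trans (𝟙-∧ (layer v ~ toℕ p) _) (cong (𝟙 (layer v ~ toℕ p) *_)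
      (trans (𝟙-∧ (active v ∧ (toℕ x <ᵇ ν (toℕ p))) _) (cong (_* 𝟙 (match (layer v) (toℕ p) (colour v) (toℕ y))) (𝟙-∧ (active v) _))))

  count-match : ∀ p q y → y < B → sum {B} (λ z → 𝟙 (match p q y (toℕ z))) ≡ c p q
  count-match p q y y<B with junction (p ⊓ q)
  ... | true  = count-≡ y y<B
  ... | false = sum-const B 1

  count-slots : ∀ p K → p < L → sum {S} (λ x → 𝟙 (toℕ x <ᵇ ν p) * K) ≡ ν p * K
  count-slots p K p<L = trans (sym (*-distribʳ-sum {S} K (λ x → 𝟙 (toℕ x <ᵇ ν p)))) (cong (_* K) (count-< (ν p) (^-monoʳ-≤ B (capacity p p<L))))

  count-neighbours : ∀ p q y K → y < B → q < L →
    sum {S} (λ x → sum {B} (λ z → 𝟙 (toℕ x <ᵇ ν q) * 𝟙 (match p q y (toℕ z)) * K)) ≡ ν q * c p q * K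
  count-neighbours p q y K y<B q<L = begin-equality
    sum {S} (λ x → sum {B} (λ z → 𝟙 (toℕ x <ᵇ ν q) * 𝟙 (match p q y (toℕ z)) * K))
      ≡⟨ sum-cong-≗ {S} (λ x → trans (sym (*-distribʳ-sum {B} K (λ z → 𝟙 (toℕ x <ᵇ ν q) * 𝟙 (match p q y (toℕ z)))))
           (trans (cong (_* K) (trans (sym (*-distribˡ-sum {B} (𝟙 (toℕ x <ᵇ ν q)) (λ z → 𝟙 (match p q y (toℕ z))))) (cong (𝟙 (toℕ x <ᵇ ν q) *_) (count-match p q y y<B))))
             (*-assoc (𝟙 (toℕ x <ᵇ ν q)) (c p q) K))) ⟩
    sum {S} (λ x → 𝟙 (toℕ x <ᵇ ν q) * (c p q * K)) ≡⟨ count-slots q (c p q * K) q<L ⟩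
    ν q * (c p q * K)                          ≡⟨ *-assoc (ν q) (c p q) K ⟨
    ν q * c p q * K                            ∎

  into : Vertex → Fin L → (Vertex → ℕ) → ℕ
  into v q F = sum (λ x → sum (λ y → A v (vertex q x y) * F (vertex q x y)))

  -- After scaling by s the step costs the same factor d between any two neighbouring layers.
  into-upper : ∀ v q F K → (∀ x y → (layer v ~ toℕ q) ≡ true → s (toℕ q) * F (vertex q x y) ≤ K) →
    s (layer v) * into v q F ≤ 𝟙 (layer v ~ toℕ q) * (d * K)
  into-upper v q F K hF with layer v ~ toℕ q in eq
  ... | false = ≤-reflexive (trans (cong (s (layer v) *_) vanish) (*-zeroʳ (s (layer v))))
    where
    vanish : into v q F ≡ 0
    vanish = trans (sum-cong-≗ (λ x → trans (sum-cong-≗ (λ y → cong (_* F (vertex q x y))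
      (trans (A-vertex v q x y) (cong (λ b → 𝟙 b * (𝟙 (active v) * 𝟙 (toℕ x <ᵇ ν (toℕ q)) * 𝟙 (match (layer v) (toℕ q) (colour v) (toℕ y)))) eq)))) (count-zero B))) (count-zero S)
  ... | true = *-cancelˡ-≤ (s q′) {{s≢0 q′}} (begin
    s q′ * (s p * into v q F)             ≡⟨ x∙yz≈y∙xz (s q′) (s p) (into v q F) ⟩
    s p * (s q′ * into v q F)             ≡⟨ cong (s p *_) (trans (*-distribˡ-sum (s q′) (λ x → sum (λ y → A v (vertex q x y) * F (vertex q x y))))
                                               (sum-cong-≗ (λ x → *-distribˡ-sum (s q′) (λ y → A v (vertex q x y) * F (vertex q x y))))) ⟩
    s p * sum (λ x → sum (λ y → s q′ * (A v (vertex q x y) * F (vertex q x y))))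
      ≤⟨ *-monoʳ-≤ (s p) (sum-mono (λ x → sum-mono (λ y → pointwise x y))) ⟩
    s p * sum {S} (λ x → sum {B} (λ y → 𝟙 (toℕ x <ᵇ ν q′) * 𝟙 (match p q′ (colour v) (toℕ y)) * K))
      ≡⟨ cong (s p *_) (count-neighbours p q′ (colour v) K (colour<B v) (toℕ<n q)) ⟩
    s p * (ν q′ * c p q′ * K)             ≡⟨ *-assoc (s p) _ K ⟨
    s p * (ν q′ * c p q′) * K             ≡⟨ cong (_* K) (degree p q′ eq (layer<L v) (toℕ<n q)) ⟩
    d * s q′ * K                          ≡⟨ rearrange d (s q′) K ⟩
    s q′ * (1 * (d * K))                  ∎)
    where
    p = layer v
    q′ = toℕ q
    rearrange : ∀ d u k → d * u * k ≡ u * (1 * (d * k))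
    rearrange = solve-∀
    A-upper : ∀ x y → A v (vertex q x y) ≤ 𝟙 (toℕ x <ᵇ ν q′) * 𝟙 (match p q′ (colour v) (toℕ y))
    A-upper x y = begin
      A v (vertex q x y) ≡⟨ A-vertex v q x y ⟩
      𝟙 (p ~ q′) * (𝟙 (active v) * X * Y) ≤⟨ *-mono-≤ (𝟙≤1 (p ~ q′)) (*-monoˡ-≤ Y (*-monoˡ-≤ X (𝟙≤1 (active v)))) ⟩
      1 * (1 * X * Y) ≡⟨ units X Y ⟩
      X * Y ∎
      where
      X = 𝟙 (toℕ x <ᵇ ν q′)
      Y = 𝟙 (match p q′ (colour v) (toℕ y))
      units : ∀ x y → 1 * (1 * x * y) ≡ x * y
      units = solve-∀
    pointwise : ∀ x y → s q′ * (A v (vertex q x y) * F (vertex q x y)) ≤ 𝟙 (toℕ x <ᵇ ν q′) * 𝟙 (match p q′ (colour v) (toℕ y)) * K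
    pointwise x y = ≤-trans (≤-reflexive (x∙yz≈y∙xz (s q′) (A v (vertex q x y)) (F (vertex q x y)))) (*-mono-≤ (A-upper x y) (hF x y refl))

  into-lower : ∀ v q F K → active v ≡ true → (layer v ~ toℕ q) ≡ true →
    (∀ x y → (toℕ x <ᵇ ν (toℕ q)) ≡ true → K ≤ s (toℕ q) * F (vertex q x y)) →
    d * K ≤ s (layer v) * into v q F
  into-lower v q F K act eq hF = *-cancelˡ-≤ (s q′) {{s≢0 q′}} (begin
    s q′ * (d * K)                        ≡⟨ rearrange d (s q′) K ⟩
    d * s q′ * K                          ≡⟨ cong (_* K) (degree p q′ eq (layer<L v) (toℕ<n q)) ⟨
    s p * (ν q′ * c p q′) * K             ≡⟨ *-assoc (s p) _ K ⟩
    s p * (ν q′ * c p q′ * K)             ≡⟨ cong (s p *_) (count-neighbours p q′ (colour v) K (colour<B v) (toℕ<n q)) ⟨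
    s p * sum {S} (λ x → sum {B} (λ y → 𝟙 (toℕ x <ᵇ ν q′) * 𝟙 (match p q′ (colour v) (toℕ y)) * K))
      ≤⟨ *-monoʳ-≤ (s p) (sum-mono (λ x → sum-mono (λ y → pointwise x y))) ⟩
    s p * sum (λ x → sum (λ y → s q′ * (A v (vertex q x y) * F (vertex q x y))))
      ≡⟨ cong (s p *_) (trans (*-distribˡ-sum (s q′) (λ x → sum (λ y → A v (vertex q x y) * F (vertex q x y))))
           (sum-cong-≗ (λ x → *-distribˡ-sum (s q′) (λ y → A v (vertex q x y) * F (vertex q x y))))) ⟨
    s p * (s q′ * into v q F)             ≡⟨ x∙yz≈y∙xz (s p) (s q′) (into v q F) ⟩
    s q′ * (s p * into v q F)             ∎)
    where
    p = layer v
    q′ = toℕ q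
    rearrange : ∀ d u k → u * (d * k) ≡ d * u * k
    rearrange = solve-∀
    A-value : ∀ x y → A v (vertex q x y) ≡ 𝟙 (toℕ x <ᵇ ν q′) * 𝟙 (match p q′ (colour v) (toℕ y))
    A-value x y = trans (A-vertex v q x y) (trans (cong₂ (λ b b′ → 𝟙 b * (𝟙 b′ * X * Y)) eq act) (units X Y))
      where
      X = 𝟙 (toℕ x <ᵇ ν q′)
      Y = 𝟙 (match p q′ (colour v) (toℕ y))
      units : ∀ x y → 1 * (1 * x * y) ≡ x * y
      units = solve-∀
    pointwise : ∀ x y → 𝟙 (toℕ x <ᵇ ν q′) * 𝟙 (match p q′ (colour v) (toℕ y)) * K ≤ s q′ * (A v (vertex q x y) * F (vertex q x y))
    pointwise x y with toℕ x <ᵇ ν q′ in x<ν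
    ... | false = z≤n
    ... | true  = begin
      1 * Y * K ≤⟨ *-monoʳ-≤ (1 * Y) (hF x y x<ν) ⟩
      1 * Y * (s q′ * F (vertex q x y)) ≡⟨ x∙yz≈y∙xz (1 * Y) (s q′) (F (vertex q x y)) ⟩
      s q′ * (1 * Y * F (vertex q x y)) ≡⟨ cong (λ z → s q′ * (z * F (vertex q x y))) (trans (A-value x y) (cong (λ b → 𝟙 b * Y) x<ν)) ⟨
      s q′ * (A v (vertex q x y) * F (vertex q x y)) ∎
      where Y = 𝟙 (match p q′ (colour v) (toℕ y))

  a-suc : ∀ m v → a (suc m) v ≡ sum (λ q → into v q (a m))
  a-suc m v = sum-vertices (λ v′ → A v v′ * a m v′)

  -- At most 2^m routes of layers leave v, and each is estimated by its end layer. The factor g is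
  -- carried along so that E can depend on the starting layer: `w-upper` takes g = s_p.
  a-upper : ∀ m g E v → (∀ j → LayerWalk L (layer v) j m → g * s j ≤ E) → g * (s (layer v) * a m v) ≤ (2 * d) ^ m * E
  a-upper zero    g E v hE = ≤-trans (≤-reflexive (cong (g *_) (*-identityʳ (s (layer v))))) (≤-trans (hE (layer v) done) (≤-reflexive (sym (+-identityʳ E))))
  a-upper (suc m) g E v hE = begin
    g * (s (layer v) * a (suc m) v)                      ≡⟨ x∙yz≈y∙xz g (s (layer v)) (a (suc m) v) ⟩
    s (layer v) * (g * a (suc m) v)                      ≡⟨ cong (λ z → s (layer v) * (g * z)) (a-suc m v) ⟩
    s (layer v) * (g * sum (λ q → into v q (a m)))       ≡⟨ cong (s (layer v) *_) (trans (*-distribˡ-sum g (λ q → into v q (a m))) (sum-cong-≗ scale)) ⟩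
    s (layer v) * sum (λ q → into v q (λ v′ → g * a m v′)) ≡⟨ *-distribˡ-sum (s (layer v)) (λ q → into v q (λ v′ → g * a m v′)) ⟩
    sum (λ q → s (layer v) * into v q (λ v′ → g * a m v′))
      ≤⟨ sum-mono (λ q → into-upper v q (λ v′ → g * a m v′) ((2 * d) ^ m * E) (ih q)) ⟩
    sum {L} (λ q → 𝟙 (layer v ~ toℕ q) * (d * ((2 * d) ^ m * E))) ≡⟨ *-distribʳ-sum {L} (d * ((2 * d) ^ m * E)) (λ q → 𝟙 (layer v ~ toℕ q)) ⟨
    sum {L} (λ q → 𝟙 (layer v ~ toℕ q)) * (d * ((2 * d) ^ m * E)) ≤⟨ *-monoˡ-≤ (d * ((2 * d) ^ m * E)) (count-~ L (layer v)) ⟩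
    2 * (d * ((2 * d) ^ m * E))                          ≡⟨ rearrange d ((2 * d) ^ m) E ⟩
    (2 * d) ^ suc m * E                                  ∎
    where
    rearrange : ∀ d e k → 2 * (d * (e * k)) ≡ 2 * d * e * k
    rearrange = solve-∀
    scale : ∀ q → g * into v q (a m) ≡ into v q (λ v′ → g * a m v′)
    scale q = trans (*-distribˡ-sum g (λ x → sum (λ y → A v (vertex q x y) * a m (vertex q x y)))) (sum-cong-≗ (λ x →
      trans (*-distribˡ-sum g (λ y → A v (vertex q x y) * a m (vertex q x y))) (sum-cong-≗ (λ y → x∙yz≈y∙xz g (A v (vertex q x y)) (a m (vertex q x y))))))
    ih : ∀ q x y → (layer v ~ toℕ q) ≡ true → s (toℕ q) * (g * a m (vertex q x y)) ≤ (2 * d) ^ m * E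
    ih q x y vq = ≤-trans (≤-reflexive (trans (x∙yz≈y∙xz (s (toℕ q)) g (a m (vertex q x y)))
        (cong (λ e → g * (s e * a m (vertex q x y))) (sym (layer-vertex q x y)))))
      (a-upper m g E (vertex q x y) (λ j lw → hE j (step vq (toℕ<n q) (subst (λ e → LayerWalk L e j m) (layer-vertex q x y) lw))))

  active-vertex : ∀ p x y → active (vertex p x y) ≡ (toℕ x <ᵇ ν (toℕ p))
  active-vertex p x y = cong₂ (λ e f → e <ᵇ ν f) (slot-vertex p x y) (layer-vertex p x y)

  a-lower : ∀ {p j m} → LayerWalk L p j m → ∀ v → layer v ≡ p → active v ≡ true → d ^ m * s j ≤ s p * a m v
  a-lower {p} done v lv act = ≤-reflexive (trans (+-identityʳ (s p)) (sym (*-identityʳ (s p))))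
  a-lower {_} {j} {suc m} (step {q = q} pq q<L lw) v refl act = begin
    d * d ^ m * s j                     ≡⟨ *-assoc d (d ^ m) (s j) ⟩
    d * (d ^ m * s j)                   ≤⟨ into-lower v q′ (a m) (d ^ m * s j) act (subst (λ e → (layer v ~ e) ≡ true) (sym (toℕ-fromℕ< q<L)) pq) ih ⟩
    s (layer v) * into v q′ (a m)       ≤⟨ *-monoʳ-≤ (s (layer v)) (≤-trans (term≤sum (λ q → into v q (a m)) q′) (≤-reflexive (sym (a-suc m v)))) ⟩
    s (layer v) * a (suc m) v           ∎
    where
    q′ = fromℕ< q<L
    ih : ∀ x y → (toℕ x <ᵇ ν (toℕ q′)) ≡ true → d ^ m * s j ≤ s (toℕ q′) * a m (vertex q′ x y)
    ih x y x<ν = subst (λ e → d ^ m * s j ≤ s e * a m (vertex q′ x y)) (sym (toℕ-fromℕ< q<L))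
      (a-lower lw (vertex q′ x y) (trans (layer-vertex q′ x y) (toℕ-fromℕ< q<L)) (trans (active-vertex q′ x y) x<ν))

  -- Inactive vertices are isolated. They still count as walks of length 0, hence the positive
  -- length here and in `w-upper`.
  inactive-a : ∀ m v → a (suc m) v ≤ 𝟙 (active v) * a (suc m) v
  inactive-a m v = cases (active v) refl
    where
    isolated : active v ≡ false → ∀ v′ → A v v′ ≡ 0
    isolated eq v′ = trans (cong (λ b → 𝟙 ((layer v ~ layer v′) ∧ ((b ∧ active v′) ∧ match (layer v) (layer v′) (colour v) (colour v′)))) eq)
      (trans (𝟙-∧ (layer v ~ layer v′) false) (*-zeroʳ (𝟙 (layer v ~ layer v′))))
    cases : ∀ b → active v ≡ b → a (suc m) v ≤ 𝟙 b * a (suc m) v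
    cases true  _  = ≤-reflexive (sym (+-identityʳ _))
    cases false eq = ≤-reflexive (trans (sum-cong-≗ (λ v′ → cong (_* a m v′) (isolated eq v′))) (count-zero (L * (S * B))))

  layer-sum : ∀ p K → p < L → sum {S} (λ x → sum {B} (λ _ → 𝟙 (toℕ x <ᵇ ν p) * K)) ≡ s p * s p * K
  layer-sum p K p<L = begin-equality
    sum {S} (λ x → sum {B} (λ _ → 𝟙 (toℕ x <ᵇ ν p) * K)) ≡⟨ sum-cong-≗ {S} (λ x → trans (sum-const B (𝟙 (toℕ x <ᵇ ν p) * K)) (x∙yz≈y∙xz B (𝟙 (toℕ x <ᵇ ν p)) K)) ⟩
    sum {S} (λ x → 𝟙 (toℕ x <ᵇ ν p) * (B * K)) ≡⟨ count-slots p (B * K) p<L ⟩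
    ν p * (B * K)                          ≡⟨ *-assoc (ν p) B K ⟨
    ν p * B * K                            ≡⟨ cong (_* K) (ν*B p) ⟩
    s p * s p * K                          ∎

  w-upper : ∀ m E → (∀ p j → p < L → LayerWalk L p j (suc m) → s p * s j ≤ E) → w (suc m) ≤ L * ((2 * d) ^ suc m * E)
  w-upper m E hE = ≤-trans (≤-reflexive (sum-vertices (a (suc m)))) (sum-bound _ ((2 * d) ^ suc m * E) per-layer)
    where
    K = (2 * d) ^ suc m * E
    per-layer : ∀ (p : Fin L) → sum (λ x → sum (λ y → a (suc m) (vertex p x y))) ≤ K
    per-layer p = *-cancelˡ-≤ (s p′ * s p′) {{m*n≢0 (s p′) (s p′) {{s≢0 p′}} {{s≢0 p′}}}} (begin
      s p′ * s p′ * sum (λ x → sum (λ y → a (suc m) (vertex p x y)))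
        ≡⟨ trans (*-distribˡ-sum (s p′ * s p′) (λ x → sum (λ y → a (suc m) (vertex p x y)))) (sum-cong-≗ (λ x → *-distribˡ-sum (s p′ * s p′) (λ y → a (suc m) (vertex p x y)))) ⟩
      sum (λ x → sum (λ y → s p′ * s p′ * a (suc m) (vertex p x y)))
        ≤⟨ sum-mono (λ x → sum-mono (λ y → pointwise x y)) ⟩
      sum {S} (λ x → sum {B} (λ _ → 𝟙 (toℕ x <ᵇ ν p′) * K)) ≡⟨ layer-sum p′ K (toℕ<n p) ⟩
      s p′ * s p′ * K ∎)
      where
      p′ = toℕ p
      pointwise : ∀ x y → s p′ * s p′ * a (suc m) (vertex p x y) ≤ 𝟙 (toℕ x <ᵇ ν p′) * K
      pointwise x y = begin
        s p′ * s p′ * a (suc m) v ≤⟨ *-monoʳ-≤ (s p′ * s p′) (inactive-a m v) ⟩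
        s p′ * s p′ * (𝟙 (active v) * a (suc m) v) ≡⟨ cong (λ b → s p′ * s p′ * (𝟙 b * a (suc m) v)) (active-vertex p x y) ⟩
        s p′ * s p′ * (𝟙 (toℕ x <ᵇ ν p′) * a (suc m) v) ≡⟨ rearrange (s p′) (𝟙 (toℕ x <ᵇ ν p′)) (a (suc m) v) ⟩
        𝟙 (toℕ x <ᵇ ν p′) * (s p′ * (s p′ * a (suc m) v)) ≡⟨ cong (λ e → 𝟙 (toℕ x <ᵇ ν p′) * (s p′ * (s e * a (suc m) v))) (layer-vertex p x y) ⟨
        𝟙 (toℕ x <ᵇ ν p′) * (s p′ * (s (layer v) * a (suc m) v))
          ≤⟨ *-monoʳ-≤ (𝟙 (toℕ x <ᵇ ν p′)) (a-upper (suc m) (s p′) E v (λ j lw → hE p′ j (toℕ<n p) (subst (λ e → LayerWalk L e j (suc m)) (layer-vertex p x y) lw))) ⟩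
        𝟙 (toℕ x <ᵇ ν p′) * K ∎
        where
        v = vertex p x y
        rearrange : ∀ u b z → u * u * (b * z) ≡ b * (u * (u * z))
        rearrange = solve-∀

  w-lower : ∀ p j m → p < L → LayerWalk L p j m → s p * (d ^ m * s j) ≤ w m
  w-lower p j m p<L lw = *-cancelˡ-≤ (s p) {{s≢0 p}} (begin
    s p * (s p * (d ^ m * s j))              ≡⟨ *-assoc (s p) (s p) _ ⟨
    s p * s p * (d ^ m * s j)                ≡⟨ layer-sum p (d ^ m * s j) p<L ⟨
    sum {S} (λ x → sum {B} (λ _ → 𝟙 (toℕ x <ᵇ ν p) * (d ^ m * s j))) ≤⟨ sum-mono (λ x → sum-mono (λ y → pointwise x y)) ⟩
    sum (λ x → sum (λ y → s p * a m (vertex p′ x y)))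
      ≡⟨ trans (*-distribˡ-sum (s p) (λ x → sum (λ y → a m (vertex p′ x y)))) (sum-cong-≗ (λ x → *-distribˡ-sum (s p) (λ y → a m (vertex p′ x y)))) ⟨
    s p * sum (λ x → sum (λ y → a m (vertex p′ x y)))
      ≤⟨ *-monoʳ-≤ (s p) (≤-trans (term≤sum (λ q → sum (λ x → sum (λ y → a m (vertex q x y)))) p′) (≤-reflexive (sym (sum-vertices (a m))))) ⟩
    s p * w m ∎)
    where
    p′ = fromℕ< p<L
    pointwise : ∀ x y → 𝟙 (toℕ x <ᵇ ν p) * (d ^ m * s j) ≤ s p * a m (vertex p′ x y)
    pointwise x y with toℕ x <ᵇ ν p in x<ν
    ... | false = z≤n
    ... | true  = ≤-trans (≤-reflexive (+-identityʳ _)) (a-lower lw (vertex p′ x y) (trans (layer-vertex p′ x y) (toℕ-fromℕ< p<L))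
                    (trans (active-vertex p′ x y) (trans (cong (λ e → toℕ x <ᵇ ν e) (toℕ-fromℕ< p<L)) x<ν)))

-- Up to constants, w_k is at most B^{δk+2+η}, w_ℓ is at least B^{2+h(p)+h(j)+δℓ}, and n is B^{σ+1}.
-- The numbers x and y are the deficits of these exponents against those of n^{k+1} and n^{ℓ+1}.
layered-extremal : ∀ L σ δ h junction → L > 0 →
  (∀ p → p < L → 1 + (h p + h p) ≤ σ) →
  (∀ p q → (p ~ q) ≡ true → p < L → q < L → suc (h p + h q + 𝟙 (not (junction (p ⊓ q)))) ≡ δ) →
  ∀ k ℓ x y η → 1 ≤ k → (∀ p j → p < L → LayerWalk L p j k → h p + h j ≤ η) →
  δ * k + (2 + η) + x ≡ suc σ * suc k →
  ∀ p j → p < L → LayerWalk L p j ℓ → y + (2 + (h p + h j) + δ * ℓ) ≡ suc σ * suc ℓ →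
  Extremal k ℓ x y
layered-extremal L σ δ h junction L>0 capacity balanced k@(suc m) ℓ x y η _ hη x-eq p j p<L lw y-eq = record
  { c       = L * 2 ^ k
  ; c′      = L ^ suc ℓ
  ; target  = λ B → record { graph = graphᴸ B ; nonempty = m*n≢0 L (S B * B) {{>-nonZero L>0}} {{m*n≢0 (S B) B {{m^n≢0 B σ}}}} }
  ; k-upper = upper
  ; ℓ-lower = lower
  }
  where
  open module F (B : ℕ) .{{_ : NonZero B}} = Layered L σ δ h junction capacity balanced B using (graphᴸ; S; d; s; w-upper; w-lower)
  size : ∀ B .{{_ : NonZero B}} → L * (B ^ σ * B) ≡ L * B ^ suc σ
  size B = cong (L *_) (*-comm (B ^ σ) B)
  upper : ∀ B .{{_ : NonZero B}} → let open Walks (graphᴸ B) in w k * B ^ x ≤ L * 2 ^ k * (L * (B ^ σ * B)) ^ suc k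
  upper B = begin
    w k * B ^ x                                      ≤⟨ *-monoˡ-≤ (B ^ x) (w-upper B m (B ^ (2 + η)) bound) ⟩
    L * ((2 * d B) ^ k * B ^ (2 + η)) * B ^ x        ≡⟨ cong (λ z → L * (z * B ^ (2 + η)) * B ^ x) (trans (^-distribʳ-* 2 (d B) k) (cong (2 ^ k *_) (^-*-assoc B δ k))) ⟩
    L * (2 ^ k * B ^ (δ * k) * B ^ (2 + η)) * B ^ x  ≡⟨ rearrange L (2 ^ k) (B ^ (δ * k)) (B ^ (2 + η)) (B ^ x) ⟩
    L * 2 ^ k * (B ^ (δ * k) * B ^ (2 + η) * B ^ x)
      ≡⟨ cong (L * 2 ^ k *_) (trans (cong (_* B ^ x) (sym (^-distribˡ-+-* B (δ * k) (2 + η)))) (sym (^-distribˡ-+-* B (δ * k + (2 + η)) x))) ⟩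
    L * 2 ^ k * B ^ (δ * k + (2 + η) + x)            ≡⟨ cong (λ e → L * 2 ^ k * B ^ e) x-eq ⟩
    L * 2 ^ k * B ^ (suc σ * suc k)                  ≡⟨ cong (L * 2 ^ k *_) (^-*-assoc B (suc σ) (suc k)) ⟨
    L * 2 ^ k * (B ^ suc σ) ^ suc k                  ≤⟨ *-monoʳ-≤ (L * 2 ^ k) (^-monoˡ-≤ (suc k) (m≤n*m (B ^ suc σ) L {{>-nonZero L>0}})) ⟩
    L * 2 ^ k * (L * B ^ suc σ) ^ suc k              ≡⟨ cong (λ z → L * 2 ^ k * z ^ suc k) (size B) ⟨
    L * 2 ^ k * (L * (B ^ σ * B)) ^ suc k            ∎
    where
    open Walks (graphᴸ B)
    rearrange : ∀ l t u v z → l * (t * u * v) * z ≡ l * t * (u * v * z)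
    rearrange = solve-∀
    bound : ∀ p j → p < L → LayerWalk L p j k → s B p * s B j ≤ B ^ (2 + η)
    bound p j p<L lw = begin
      s B p * s B j                  ≡⟨ ^-distribˡ-+-* B (suc (h p)) (suc (h j)) ⟨
      B ^ (suc (h p) + suc (h j))    ≡⟨ cong (λ e → B ^ suc e) (+-suc (h p) (h j)) ⟩
      B ^ (2 + (h p + h j))          ≤⟨ ^-monoʳ-≤ B (+-monoʳ-≤ 2 (hη p j p<L lw)) ⟩
      B ^ (2 + η)                    ∎
  lower : ∀ B .{{_ : NonZero B}} → let open Walks (graphᴸ B) in (L * (B ^ σ * B)) ^ suc ℓ ≤ L ^ suc ℓ * B ^ y * w ℓ
  lower B = begin
    (L * (B ^ σ * B)) ^ suc ℓ                ≡⟨ cong (_^ suc ℓ) (size B) ⟩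
    (L * B ^ suc σ) ^ suc ℓ                  ≡⟨ ^-distribʳ-* L (B ^ suc σ) (suc ℓ) ⟩
    L ^ suc ℓ * (B ^ suc σ) ^ suc ℓ          ≡⟨ cong (L ^ suc ℓ *_) (trans (^-*-assoc B (suc σ) (suc ℓ)) (cong (B ^_) (sym y-eq))) ⟩
    L ^ suc ℓ * B ^ (y + (2 + (h p + h j) + δ * ℓ)) ≡⟨ cong (L ^ suc ℓ *_) (^-distribˡ-+-* B y _) ⟩
    L ^ suc ℓ * (B ^ y * B ^ (2 + (h p + h j) + δ * ℓ)) ≡⟨ *-assoc (L ^ suc ℓ) (B ^ y) _ ⟨
    L ^ suc ℓ * B ^ y * B ^ (2 + (h p + h j) + δ * ℓ) ≡⟨ cong (λ e → L ^ suc ℓ * B ^ y * B ^ e) (exponent (h p) (h j) (δ * ℓ)) ⟩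
    L ^ suc ℓ * B ^ y * B ^ (suc (h p) + (δ * ℓ + suc (h j)))
      ≡⟨ cong (L ^ suc ℓ * B ^ y *_) (trans (^-distribˡ-+-* B (suc (h p)) (δ * ℓ + suc (h j)))
           (cong (s B p *_) (trans (^-distribˡ-+-* B (δ * ℓ) (suc (h j))) (cong (_* s B j) (sym (^-*-assoc B δ ℓ)))))) ⟩
    L ^ suc ℓ * B ^ y * (s B p * (d B ^ ℓ * s B j)) ≤⟨ *-monoʳ-≤ (L ^ suc ℓ * B ^ y) (w-lower B p j ℓ p<L lw) ⟩
    L ^ suc ℓ * B ^ y * w ℓ ∎
    where
    open Walks (graphᴸ B)
    exponent : ∀ u v e → 2 + (u + v) + e ≡ suc u + (e + suc v)
    exponent = solve-∀

-- Parity, and walks on the path of layers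

even? : ℕ → Bool
even? zero    = true
even? (suc m) = not (even? m)

true≢false : true ≢ false
true≢false ()

even?-+-even : ∀ m e → even? e ≡ true → even? (m + e) ≡ even? m
even?-+-even zero    e h = h
even?-+-even (suc m) e h = cong not (even?-+-even m e h)

even?-+-odd : ∀ m e → even? e ≡ false → even? (m + e) ≡ not (even? m)
even?-+-odd zero    e h = h
even?-+-odd (suc m) e h = cong not (even?-+-odd m e h)

even?-double : ∀ m → even? (m * 2) ≡ true
even?-double zero    = refl
even?-double (suc m) = cong (not ∘ not) (even?-double m)

even?-*-even : ∀ c e → even? e ≡ true → even? (c * e) ≡ true
even?-*-even zero    e h = refl
even?-*-even (suc c) e h = trans (even?-+-even e (c * e) (even?-*-even c e h)) h

data Parity : ℕ → Set where
  even : ∀ j → Parity (j * 2)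
  odd  : ∀ j → Parity (1 + j * 2)

parity : ∀ m → Parity m
parity zero = even 0
parity (suc m) with parity m
... | even j = odd j
... | odd j  = even (suc j)

~-parity : ∀ p q → (p ~ q) ≡ true → even? p ≡ not (even? q)
~-parity p q pq with ~-cases p q pq
... | inj₁ refl = sym (not-involutive (even? p))
... | inj₂ refl = refl

layerWalk-parity : ∀ {L p j m} → LayerWalk L p j m → even? p ≡ even? (j + m)
layerWalk-parity {j = j} done = cong even? (sym (+-identityʳ j))
layerWalk-parity {p = p} {j} {suc m} (step {q = q} pq _ lw) =
  trans (~-parity p q pq) (trans (cong not (layerWalk-parity lw)) (cong even? (sym (+-suc j m))))

layerWalk-odd : ∀ {L p j m} → even? m ≡ false → LayerWalk L p j m → even? p ≡ not (even? j)
layerWalk-odd {j = j} {m} h lw = trans (layerWalk-parity lw) (even?-+-odd j m h)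

~-≤ : ∀ p q → (p ~ q) ≡ true → q ≤ suc p
~-≤ p q pq with ~-cases p q pq
... | inj₁ refl = ≤-refl
... | inj₂ refl = m≤n⇒m≤1+n (n≤1+n q)

layerWalk-≤ : ∀ {L p j m} → LayerWalk L p j m → j ≤ p + m
layerWalk-≤ {p = p} done = m≤m+n p 0
layerWalk-≤ {p = p} {j} {suc m} (step {q = q} pq _ lw) =
  ≤-trans (layerWalk-≤ lw) (≤-trans (+-monoˡ-≤ m (~-≤ p q pq)) (≤-reflexive (sym (+-suc p m))))

layerWalk-≥ : ∀ {L p j m} → LayerWalk L p j m → p ≤ j + m
layerWalk-≥ {p = p} done = m≤m+n p 0
layerWalk-≥ {p = p} {j} {suc m} (step {q = q} pq _ lw) =
  ≤-trans (~-≤ q p (trans (~-comm q p) pq)) (≤-trans (s≤s (layerWalk-≥ lw)) (≤-reflexive (sym (+-suc j m))))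

layerWalk-end : ∀ {L p j m} → p < L → LayerWalk L p j m → j < L
layerWalk-end p<L done          = p<L
layerWalk-end p<L (step _ q lw) = layerWalk-end q lw

straight : ∀ {L} m p → p + m < L → LayerWalk L p (p + m) m
straight {L} zero    p _ = subst (λ j → LayerWalk L p j 0) (sym (+-identityʳ p)) done
straight {L} (suc m) p h = step (~-suc p) (≤-trans (s≤s (≤-trans (m≤m+n (suc p) m) (≤-reflexive (sym (+-suc p m))))) h)
  (subst (λ j → LayerWalk L (suc p) j m) (sym (+-suc p m)) (straight m (suc p) (subst (_< L) (+-suc p m) h)))

-- The end layer is left open: where this walk is used, h is constant.
bounce : ∀ m p → p < 2 → Σ ℕ (λ j → LayerWalk 2 p j m)
bounce zero    p _ = p , done
bounce (suc m) zero       _ = let j , lw = bounce m 1 ≤-refl in j , step refl ≤-refl lw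
bounce (suc m) (suc zero) _ = let j , lw = bounce m 0 (s≤s z≤n) in j , step refl (s≤s z≤n) lw
bounce (suc m) (suc (suc _)) (s≤s (s≤s ()))

bounce-back : ∀ i → LayerWalk 2 1 1 (i * 2)
bounce-back zero    = done
bounce-back (suc i) = step refl (s≤s z≤n) (step refl ≤-refl (bounce-back i))

-- Extremal families

-- One copy of K_{B,B} for each of the B colours: 2B² vertices, all of degree B.
regular-extremal : ∀ k ℓ → 1 ≤ k → Extremal k ℓ k ℓ
regular-extremal k ℓ 1≤k = layered-extremal 2 1 1 (λ _ → 0) (λ _ → true) (s≤s z≤n) (λ _ _ → ≤-refl) (λ _ _ _ _ _ → refl)
  k ℓ k ℓ 0 1≤k (λ _ _ _ _ → ≤-refl) (x-eq k) 0 (proj₁ walk) (s≤s z≤n) (proj₂ walk) (y-eq ℓ)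
  where
  walk = bounce ℓ 0 (s≤s z≤n)
  x-eq : ∀ k → 1 * k + 2 + k ≡ 2 * suc k
  x-eq = solve-∀
  y-eq : ∀ ℓ → ℓ + (2 + 1 * ℓ) ≡ 2 * suc ℓ
  y-eq = solve-∀

-- K_{B²,B⁴} inside 2B⁴ vertices. Walks of odd length use both sides equally often; a walk of even
-- length starting on the large side visits it once more.
star-extremal : ∀ k i → 1 ≤ k → even? k ≡ false → Extremal k (i * 2) (suc k) (i * 2)
star-extremal k i 1≤k k-odd = layered-extremal 2 3 3 h (λ _ → false) (s≤s z≤n)
  (λ p _ → s≤s (+-mono-≤ (𝟙≤1 (not (even? p))) (𝟙≤1 (not (even? p)))))
  (λ p q pq _ _ → cong (λ e → suc (e + 1)) (opposite p q (~-parity p q pq)))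
  k (i * 2) (suc k) (i * 2) 1 1≤k (λ p j _ lw → ≤-reflexive (opposite p j (layerWalk-odd k-odd lw))) (x-eq k)
  1 1 ≤-refl (bounce-back i) (y-eq (i * 2))
  where
  h : ℕ → ℕ
  h p = 𝟙 (not (even? p))
  opposite : ∀ p q → even? p ≡ not (even? q) → h p + h q ≡ 1
  opposite p q eq rewrite eq with even? q
  ... | true  = refl
  ... | false = refl
  x-eq : ∀ k → 3 * k + 3 + suc k ≡ 4 * suc k
  x-eq = solve-∀
  y-eq : ∀ ℓ → ℓ + (4 + 3 * ℓ) ≡ 4 * suc ℓ
  y-eq = solve-∀

-- K_{B²,B²} inside 2B³ vertices: each vertex of a path costs a factor B.
isolated-extremal : ∀ k ℓ → 1 ≤ k → Extremal k ℓ (suc k) (suc ℓ)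
isolated-extremal k ℓ 1≤k = layered-extremal 2 2 2 (λ _ → 0) (λ _ → false) (s≤s z≤n) (λ _ _ → s≤s z≤n) (λ _ _ _ _ _ → refl)
  k ℓ (suc k) (suc ℓ) 0 1≤k (λ _ _ _ _ → ≤-refl) (x-eq k) 0 (proj₁ walk) (s≤s z≤n) (proj₂ walk) (y-eq ℓ)
  where
  walk = bounce ℓ 0 (s≤s z≤n)
  x-eq : ∀ k → 2 * k + 2 + suc k ≡ 3 * suc k
  x-eq = solve-∀
  y-eq : ∀ ℓ → suc ℓ + (2 + 2 * ℓ) ≡ 3 * suc ℓ
  y-eq = solve-∀

-- The layers 0 … ℓ are cut into blocks of k + 1. Along even layers the size decreases and along
-- odd layers it increases from block to block, with a junction after each multiple of k + 1; a walk of
-- odd length k joins an even to an odd layer and can pass at most one junction.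
module Blocks (k c r : ℕ) (1≤k : 1 ≤ k) (k-odd : even? k ≡ false) (r<K : r < suc k) (r-odd : even? r ≡ false) where

  K ℓ : ℕ
  K = suc k
  ℓ = r + c * K

  K-even : even? K ≡ true
  K-even = cong not k-odd

  block-/ : ∀ ρ b → ρ < K → (ρ + b * K) / K ≡ b
  block-/ ρ b ρ<K = trans (+-distrib-/-∣ʳ ρ (n∣m*n b)) (cong₂ _+_ (m<n⇒m/n≡0 ρ<K) (m*n/n≡m b K))

  block-even? : ∀ ρ b → even? (ρ + b * K) ≡ even? ρ
  block-even? ρ b = even?-+-even ρ (b * K) (even?-*-even b K K-even)

  -- The quotient (p + k) / K is p / K rounded up. For even p and odd j, h(p) + h(j) is thus c + 2
  -- plus the difference between j / K rounded down and p / K rounded up. For adjacent layers it is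
  -- c + 2 at a junction and c + 1 elsewhere, as `balanced` demands.
  h : ℕ → ℕ
  h p = if even? p then suc c ∸ (p + k) / K else suc (p / K)

  h-even : ∀ p → even? p ≡ true → h p ≡ suc c ∸ (p + k) / K
  h-even p e = cong (λ b → if b then suc c ∸ (p + k) / K else suc (p / K)) e

  h-odd : ∀ p → even? p ≡ false → h p ≡ suc (p / K)
  h-odd p e = cong (λ b → if b then suc c ∸ (p + k) / K else suc (p / K)) e

  junction : ℕ → Bool
  junction p = p % K ≡ᵇ 0

  p/K≤c : ∀ p → p < suc ℓ → p / K ≤ c
  p/K≤c p (s≤s p≤ℓ) = ≤-trans (/-monoˡ-≤ K p≤ℓ) (≤-reflexive (block-/ r c r<K))

  ceil≤ : ∀ p → p < suc ℓ → (p + k) / K ≤ suc c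
  ceil≤ p (s≤s p≤ℓ) = ≤-trans (/-monoˡ-≤ K (≤-trans (+-monoˡ-≤ k p≤ℓ) (+-monoʳ-≤ ℓ (n≤1+n k))))
    (≤-reflexive (trans (cong (_/ K) (+-assoc-comm r (c * K) K)) (block-/ r (suc c) r<K)))
    where
    +-assoc-comm : ∀ r e K → r + e + K ≡ r + (K + e)
    +-assoc-comm = solve-∀

  capacity : ∀ p → p < suc ℓ → 1 + (h p + h p) ≤ 3 + (c + c)
  capacity p p<L = ≤-trans (s≤s (+-mono-≤ h≤ h≤)) (≤-reflexive (cong (2 +_) (+-suc c c)))
    where
    h≤ : h p ≤ suc c
    h≤ with even? p
    ... | true  = m∸n≤m (suc c) ((p + k) / K)
    ... | false = s≤s (p/K≤c p p<L)

  odd-no-junction : ∀ p → even? p ≡ false → junction p ≡ false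
  odd-no-junction p p-odd with p % K in eq
  ... | suc _ = refl
  ... | zero  = ⊥-elim (true≢false (trans (sym (trans (cong even? p≡) (even?-*-even (p / K) K K-even))) p-odd))
    where
    p≡ : p ≡ p / K * K
    p≡ = trans (m≡m%n+[m/n]*n p K) (cong (_+ p / K * K) eq)

  -- Consecutive layers p, p + 1 with p = ρ + b (k + 1).
  even-step : ∀ ρ b → ρ < K → even? ρ ≡ true → b ≤ c →
    suc c ∸ (ρ + b * K + k) / K + suc (suc (ρ + b * K) / K) + 𝟙 (not (ρ ≡ᵇ 0)) ≡ 2 + c
  even-step zero    b _   _   b≤c = begin-equality
    suc c ∸ (b * K + k) / K + suc (suc (b * K) / K) + 0
      ≡⟨ cong₂ (λ u v → suc c ∸ u + suc v + 0) (trans (cong (_/ K) (+-comm (b * K) k)) (block-/ k b ≤-refl)) (block-/ 1 b (s≤s 1≤k)) ⟩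
    suc c ∸ b + suc b + 0 ≡⟨ trans (+-identityʳ _) (+-suc (suc c ∸ b) b) ⟩
    suc (suc c ∸ b + b)   ≡⟨ cong suc (m∸n+n≡m (m≤n⇒m≤1+n b≤c)) ⟩
    2 + c                 ∎
  even-step (suc ρ) b (s≤s ρ<k) ρ-even b≤c = begin-equality
    suc c ∸ (suc ρ + b * K + k) / K + suc ((2 + ρ + b * K) / K) + 1
      ≡⟨ cong₂ (λ u v → suc c ∸ u + suc v + 1) (trans (cong (_/ K) (shift ρ (b * K) k)) (block-/ ρ (suc b) (m≤n⇒m≤1+n ρ<k))) (block-/ (2 + ρ) b 2+ρ<K) ⟩
    suc c ∸ suc b + suc b + 1 ≡⟨ cong (_+ 1) (m∸n+n≡m (s≤s b≤c)) ⟩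
    suc c + 1                 ≡⟨ +-comm (suc c) 1 ⟩
    2 + c                     ∎
    where
    shift : ∀ ρ e k → suc ρ + e + k ≡ ρ + (suc k + e)
    shift = solve-∀
    -- The even number ρ + 1 is not the odd k, so the next layer still lies in the same block.
    2+ρ<K : 2 + ρ < K
    2+ρ<K = s≤s (≤∧≢⇒< ρ<k (λ { refl → true≢false (trans (sym ρ-even) k-odd) }))

  suc-balanced : ∀ p → p < suc ℓ → h p + h (suc p) + 𝟙 (not (junction p)) ≡ 2 + c
  suc-balanced p p<L = cases (even? p) refl
    where
    ρ = p % K
    b = p / K
    p≡ : p ≡ ρ + b * K
    p≡ = m≡m%n+[m/n]*n p K
    cases : ∀ e → even? p ≡ e → h p + h (suc p) + 𝟙 (not (junction p)) ≡ 2 + c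
    cases true p-even = begin-equality
      h p + h (suc p) + 𝟙 (not (junction p))
        ≡⟨ cong₂ (λ u v → u + v + 𝟙 (not (junction p))) (h-even p p-even) (h-odd (suc p) (cong not p-even)) ⟩
      suc c ∸ (p + k) / K + suc (suc p / K) + 𝟙 (not (junction p))
        ≡⟨ cong (λ z → suc c ∸ (z + k) / K + suc (suc z / K) + 𝟙 (not (junction p))) p≡ ⟩
      suc c ∸ (ρ + b * K + k) / K + suc (suc (ρ + b * K) / K) + 𝟙 (not (ρ ≡ᵇ 0))
        ≡⟨ even-step ρ b (m%n<n p K) (trans (sym (block-even? ρ b)) (trans (cong even? (sym p≡)) p-even)) (p/K≤c p p<L) ⟩
      2 + c ∎
    cases false p-odd = begin-equality
      h p + h (suc p) + 𝟙 (not (junction p))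
        ≡⟨ cong₂ (λ u v → u + 𝟙 (not v)) (cong₂ _+_ (h-odd p p-odd) (h-even (suc p) (cong not p-odd))) (odd-no-junction p p-odd) ⟩
      suc b + (suc c ∸ (suc p + k) / K) + 1 ≡⟨ cong (λ z → suc b + (suc c ∸ z) + 1) next ⟩
      suc b + (c ∸ b) + 1 ≡⟨ cong (λ z → suc z + 1) (m+[n∸m]≡n (p/K≤c p p<L)) ⟩
      suc c + 1           ≡⟨ +-comm (suc c) 1 ⟩
      2 + c               ∎
      where
      shift : ∀ ρ e k → suc (ρ + e) + k ≡ ρ + (suc k + e)
      shift = solve-∀
      next : (suc p + k) / K ≡ suc b
      next = trans (cong (λ z → (suc z + k) / K) p≡) (trans (cong (_/ K) (shift ρ (b * K) k)) (block-/ ρ (suc b) (m%n<n p K)))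

  balanced : ∀ p q → (p ~ q) ≡ true → p < suc ℓ → q < suc ℓ → suc (h p + h q + 𝟙 (not (junction (p ⊓ q)))) ≡ 3 + c
  balanced p q pq p<L q<L with ~-cases p q pq
  ... | inj₁ refl = cong suc (trans (cong (λ z → h p + h (suc p) + 𝟙 (not (junction z))) (m≤n⇒m⊓n≡m (n≤1+n p))) (suc-balanced p p<L))
  ... | inj₂ refl = cong suc (trans (cong₂ (λ z e → e + 𝟙 (not (junction z))) (m≥n⇒m⊓n≡n (n≤1+n q)) (+-comm (h (suc q)) (h q))) (suc-balanced q q<L))

  -- Within k steps of p, j / K rounded down cannot exceed p / K rounded up.
  even-odd-bound : ∀ p j → even? p ≡ true → even? j ≡ false → p < suc ℓ → j ≤ p + k → h p + h j ≤ 2 + c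
  even-odd-bound p j p-even j-odd p<L j≤ = begin
    h p + h j                                ≡⟨ cong₂ _+_ (h-even p p-even) (h-odd j j-odd) ⟩
    suc c ∸ (p + k) / K + suc (j / K)        ≤⟨ +-monoʳ-≤ (suc c ∸ (p + k) / K) (s≤s (/-monoˡ-≤ K j≤)) ⟩
    suc c ∸ (p + k) / K + suc ((p + k) / K)  ≡⟨ +-suc _ _ ⟩
    suc (suc c ∸ (p + k) / K + (p + k) / K)  ≡⟨ cong suc (m∸n+n≡m (ceil≤ p p<L)) ⟩
    2 + c                                    ∎

  walk-bound : ∀ p j → p < suc ℓ → LayerWalk (suc ℓ) p j k → h p + h j ≤ 2 + c
  walk-bound p j p<L lw = cases (even? j) refl
    where
    cases : ∀ e → even? j ≡ e → h p + h j ≤ 2 + c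
    cases false j-odd  = even-odd-bound p j (trans (layerWalk-odd k-odd lw) (cong not j-odd)) j-odd p<L (layerWalk-≤ lw)
    cases true  j-even = ≤-trans (≤-reflexive (+-comm (h p) (h j)))
      (even-odd-bound j p j-even (trans (layerWalk-odd k-odd lw) (cong not j-even)) (layerWalk-end p<L lw) (layerWalk-≥ lw))

  h-first : h 0 ≡ suc c
  h-first = cong (suc c ∸_) (m<n⇒m/n≡0 {k} {K} ≤-refl)

  h-last : h ℓ ≡ suc c
  h-last = trans (h-odd ℓ (trans (block-even? r c) r-odd)) (cong suc (block-/ r c r<K))

  -- The straight walk from layer 0 to layer ℓ has both ends in layers of the maximal exponent c +
  -- 1, whereas the end exponents of a walk of length k add up to at most c + 2. The choice σ = 3 +
  -- 2c lets these largest layers fill all their slots.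
  blocks-extremal : Extremal k ℓ (k + c * K) (suc c * ℓ)
  blocks-extremal = layered-extremal (suc ℓ) (3 + (c + c)) (3 + c) h junction (s≤s z≤n) capacity balanced
    k ℓ (k + c * K) (suc c * ℓ) (2 + c) 1≤k walk-bound (x-eq k c) 0 ℓ (s≤s z≤n) (straight ℓ 0 ≤-refl)
    (trans (cong₂ (λ u v → suc c * ℓ + (2 + (u + v) + (3 + c) * ℓ)) h-first h-last) (y-eq c ℓ))
    where
    x-eq : ∀ k c → (3 + c) * k + (2 + (2 + c)) + (k + c * suc k) ≡ suc (3 + (c + c)) * suc k
    x-eq = solve-∀
    y-eq : ∀ c ℓ → suc c * ℓ + (2 + (suc c + suc c) + (3 + c) * ℓ) ≡ suc (3 + (c + c)) * suc ℓ
    y-eq = solve-∀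

-- The cases of the formula: matching upper and lower bounds

isC : ∀ k ℓ p q e → (∀ G → let open Walks G in w ℓ ^ p ≤ n G ^ e * w k ^ q) →
  e + suc k * q ≡ suc ℓ * p → Extremal k ℓ p q → IsC (P k) (P ℓ) p q
isC k ℓ p q e upper eq E = admissible k ℓ p q e upper eq , λ p′ q′ _ → extremal⇒not-admissible E p′ q′

-- The bound says that (w_m / n)^{1/m} does not drop from m = ℓ to m = k; regular graphs give
-- equality.
isC-power-mean : ∀ k ℓ e → 1 ≤ k → k ≡ ℓ + e →
  (∀ G → let open Walks G in w ℓ ^ (ℓ + e) ≤ n G ^ e * w (ℓ + e) ^ ℓ) → IsC (P k) (P ℓ) k ℓ
isC-power-mean _ ℓ e 1≤k refl upper = isC (ℓ + e) ℓ (ℓ + e) ℓ e upper (exponents ℓ e) (regular-extremal (ℓ + e) ℓ 1≤k)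
  where
  exponents : ∀ ℓ e → e + suc (ℓ + e) * ℓ ≡ suc ℓ * (ℓ + e)
  exponents = solve-∀

double-∸ : ∀ {i j} → i ≤ j → i * 2 + (j ∸ i) * 2 ≡ j * 2
double-∸ {i} {j} i≤j = trans (sym (*-distribʳ-+ 2 i (j ∸ i))) (cong (_* 2) (m+[n∸m]≡n i≤j))

2∣double : ∀ j → 2 ∣ j * 2
2∣double j = divides j refl

2∤suc-double : ∀ j → ¬ 2 ∣ 1 + j * 2
2∤suc-double j (divides i eq) = true≢false (trans (sym (even?-double i)) (trans (cong even? (sym eq)) (cong not (even?-double j))))

case-longer : ∀ {k ℓ} → Parity k → Parity ℓ → ℓ < k → 2 ∣ k ⊎ (¬ 2 ∣ k × ¬ 2 ∣ ℓ) → IsC (P k) (P ℓ) k ℓ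
case-longer (even i) (even j) ℓ<k _ = isC-power-mean (i * 2) (j * 2) ((i ∸ j) * 2) (≤-trans (s≤s z≤n) ℓ<k)
  (sym (double-∸ (*-cancelʳ-≤ j i 2 (<⇒≤ ℓ<k)))) (λ G → PathInequalities.same-parity G (j * 2) (i ∸ j))
case-longer (even i) (odd j) ℓ<k _ = isC-power-mean (i * 2) (1 + j * 2) (1 + (i ∸ suc j) * 2) (≤-trans (s≤s z≤n) ℓ<k)
  (trans (sym (double-∸ (*-cancelʳ-≤ (suc j) i 2 ℓ<k))) (cong suc (sym (+-suc (j * 2) _))))
  (λ G → PathInequalities.odd-to-even G j (i ∸ suc j))
case-longer (odd i) (odd j) ℓ<k _ = isC-power-mean (1 + i * 2) (1 + j * 2) ((i ∸ j) * 2) (≤-trans (s≤s z≤n) ℓ<k)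
  (cong suc (sym (double-∸ (*-cancelʳ-≤ j i 2 (≤-pred (<⇒≤ ℓ<k)))))) (λ G → PathInequalities.same-parity G (1 + j * 2) (i ∸ j))
case-longer (odd i) (even j) _ (inj₁ 2∣k)       = ⊥-elim (2∤suc-double i 2∣k)
case-longer (odd i) (even j) _ (inj₂ (_ , 2∤ℓ)) = ⊥-elim (2∤ℓ (2∣double j))

case-odd-even : ∀ {k ℓ} → Parity k → Parity ℓ → ¬ 2 ∣ k → 2 ∣ ℓ → IsC (P k) (P ℓ) (suc k) ℓ
case-odd-even (even i) _       2∤k _   = ⊥-elim (2∤k (2∣double i))
case-odd-even (odd i)  (odd j) _   2∣ℓ = ⊥-elim (2∤suc-double j 2∣ℓ)
case-odd-even (odd i)  (even j) _  _   = isC k (j * 2) (suc k) (j * 2) (suc k) upper (exponents k (j * 2))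
    (star-extremal k j (s≤s z≤n) (cong not (even?-double i)))
  where
  k = 1 + i * 2
  -- As ℓ = 2j and k + 1 = 2(i + 1), dividing ℓ by k + 1 gives the quotient c and the even remainder
  -- 2ρ.
  ρ = j % suc i
  c = j / suc i
  index : ∀ ρ c i → ρ * 2 + c * (2 + i * 2) ≡ (ρ + c * suc i) * 2
  index = solve-∀
  ℓ≡ : ρ * 2 + c * suc k ≡ j * 2
  ℓ≡ = trans (index ρ c i) (cong (_* 2) (sym (m≡m%n+[m/n]*n j (suc i))))
  upper : ∀ G → let open Walks G in w (j * 2) ^ suc k ≤ n G ^ suc k * w k ^ (j * 2)
  upper G = subst (λ ℓ → w ℓ ^ suc k ≤ n G ^ suc k * w k ^ ℓ) ℓ≡
    (PathInequalities.even-by-odd G k (ρ * 2) (suc i ∸ ρ) (double-∸ (<⇒≤ (m%n<n j (suc i)))) c)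
    where open Walks G
  exponents : ∀ k ℓ → suc k + suc k * ℓ ≡ suc ℓ * suc k
  exponents = solve-∀

-- The bound compares w_k^{1/(k+1)} with w_ℓ^{1/(ℓ+1)} and contains no n, hence the exponent 0. In
-- the matching family isolated vertices enlarge n without changing these counts.
case-even-shorter : ∀ {k ℓ} → Parity k → Parity ℓ → 1 ≤ k → k < ℓ → 2 ∣ k → IsC (P k) (P ℓ) (suc k) (suc ℓ)
case-even-shorter (odd m)  _        _   _   2∣k = ⊥-elim (2∤suc-double m 2∣k)
case-even-shorter (even m) (even i) 1≤k k<ℓ _ = isC (m * 2) (i * 2) (suc (m * 2)) (suc (i * 2)) 0 upper
    (*-comm (suc (m * 2)) (suc (i * 2))) (isolated-extremal (m * 2) (i * 2) 1≤k)
  where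
  m≤i = *-cancelʳ-≤ m i 2 (<⇒≤ k<ℓ)
  upper : ∀ G → let open Walks G in w (i * 2) ^ suc (m * 2) ≤ 1 * w (m * 2) ^ suc (i * 2)
  upper G = ≤-trans (subst (λ z → w (z * 2) ^ suc (m * 2) ≤ w (m * 2) ^ suc (z * 2)) (m∸n+n≡m m≤i)
    (PathInequalities.even-to-even G m (i ∸ m))) (≤-reflexive (sym (*-identityˡ _)))
    where open Walks G
case-even-shorter (even m) (odd i) 1≤k k<ℓ _ = isC (m * 2) (1 + i * 2) (suc (m * 2)) (2 + i * 2) 0 upper
    (*-comm (suc (m * 2)) (2 + i * 2)) (isolated-extremal (m * 2) (1 + i * 2) 1≤k)
  where
  m≤i = *-cancelʳ-≤ m i 2 (≤-pred k<ℓ)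
  upper : ∀ G → let open Walks G in w (1 + i * 2) ^ suc (m * 2) ≤ 1 * w (m * 2) ^ (2 + i * 2)
  upper G = ≤-trans (subst (λ z → w (1 + z * 2) ^ suc (m * 2) ≤ w (m * 2) ^ (2 + z * 2)) (m∸n+n≡m m≤i)
    (PathInequalities.even-to-odd G m (i ∸ m))) (≤-reflexive (sym (*-identityˡ _)))
    where open Walks G

odd-blocks : ∀ {k r} → Parity k → Parity r → even? k ≡ false → even? r ≡ false → r < suc k → ∀ c →
  IsC (P k) (P (r + c * suc k)) (k + c * suc k) (suc c * (r + c * suc k))
odd-blocks (even i) _ k-odd _ _ _ = ⊥-elim (true≢false (trans (sym (even?-double i)) k-odd))
odd-blocks (odd _) (even j) _ r-odd _ _ = ⊥-elim (true≢false (trans (sym (even?-double j)) r-odd))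
odd-blocks (odd i) (odd j) k-odd r-odd r<K c = isC k ℓ M (suc c * ℓ) (g * 2) upper exponents
    (Blocks.blocks-extremal k c r (s≤s z≤n) k-odd r<K r-odd)
  where
  k = 1 + i * 2
  r = 1 + j * 2
  ℓ = r + c * suc k
  M = k + c * suc k
  -- The gap k - r is 2g, so lengthening ℓ by 2g gives M, which is one less than a multiple of k +
  -- 1.
  g = i ∸ j
  shift : ∀ r e f → r + e + f ≡ r + f + e
  shift = solve-∀
  ℓ+≡M : ℓ + g * 2 ≡ M
  ℓ+≡M = trans (shift r (c * suc k) (g * 2)) (cong (λ z → suc z + c * suc k) (double-∸ (*-cancelʳ-≤ j i 2 (≤-pred (≤-pred r<K)))))
  upper : ∀ G → let open Walks G in w ℓ ^ M ≤ n G ^ (g * 2) * w k ^ (suc c * ℓ)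
  upper G = subst (λ m → w ℓ ^ m ≤ n G ^ (g * 2) * w k ^ (suc c * ℓ)) ℓ+≡M (PathInequalities.odd-by-shorter-odd G k c ℓ g ℓ+≡M)
    where open Walks G
  exponents : g * 2 + suc k * (suc c * ℓ) ≡ suc ℓ * M
  exponents = begin-equality
    g * 2 + suc k * (suc c * ℓ)   ≡⟨ cong (g * 2 +_) (blocks k c ℓ) ⟩
    g * 2 + (suc M) * ℓ           ≡⟨ cong (λ m → g * 2 + suc m * ℓ) ℓ+≡M ⟨
    g * 2 + suc (ℓ + g * 2) * ℓ   ≡⟨ expand ℓ (g * 2) ⟩
    suc ℓ * (ℓ + g * 2)           ≡⟨ cong (suc ℓ *_) ℓ+≡M ⟩
    suc ℓ * M                     ∎
    where
    blocks : ∀ k c ℓ → suc k * (suc c * ℓ) ≡ suc (k + c * suc k) * ℓ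
    blocks = solve-∀
    expand : ∀ ℓ e → e + suc (ℓ + e) * ℓ ≡ suc ℓ * (ℓ + e)
    expand = solve-∀

2∤⇒odd : ∀ {m} → Parity m → ¬ 2 ∣ m → even? m ≡ false
2∤⇒odd (even j) 2∤ = ⊥-elim (2∤ (2∣double j))
2∤⇒odd (odd j)  _  = cong not (even?-double j)

case-odd-shorter : ∀ k ℓ → ¬ 2 ∣ k → ¬ 2 ∣ ℓ → IsC (P k) (P ℓ) (k + ℓ ∸ ℓ % suc k) ((ℓ / suc k + 1) * ℓ)
case-odd-shorter k ℓ 2∤k 2∤ℓ = subst₂ (λ p q → IsC (P k) (P ℓ) p q) p≡ (cong (_* ℓ) (+-comm 1 c))
    (subst (λ z → IsC (P k) (P z) (k + c * suc k) (suc c * z)) (sym ℓ≡)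
      (odd-blocks (parity k) (parity r) k-odd r-odd (m%n<n ℓ (suc k)) c))
  where
  r = ℓ % suc k
  c = ℓ / suc k
  ℓ≡ : ℓ ≡ r + c * suc k
  ℓ≡ = m≡m%n+[m/n]*n ℓ (suc k)
  k-odd = 2∤⇒odd (parity k) 2∤k
  r-odd : even? r ≡ false
  -- Since k + 1 is even, the remainder keeps the parity of ℓ.
  r-odd = trans (sym (even?-+-even r (c * suc k) (even?-*-even c (suc k) (cong not k-odd))))
    (trans (cong even? (sym ℓ≡)) (2∤⇒odd (parity ℓ) 2∤ℓ))
  p≡ : k + c * suc k ≡ k + ℓ ∸ r
  p≡ = sym (trans (cong (λ z → k + z ∸ r) ℓ≡) (trans (cong (_∸ r) (shift k r (c * suc k))) (m+n∸m≡n r _)))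
    where
    shift : ∀ k r e → k + (r + e) ≡ r + (k + e)
    shift = solve-∀

theorem3p3 : (k ℓ : ℕ) → 1 ≤ k → 1 ≤ ℓ →
    ((ℓ < k → (2 ∣ k ⊎ (¬ 2 ∣ k × ¬ 2 ∣ ℓ)) → IsC (P k) (P ℓ) k ℓ) ×
    (¬ 2 ∣ k → 2 ∣ ℓ → IsC (P k) (P ℓ) (k + 1) ℓ) ×
    (k < ℓ → 2 ∣ k → IsC (P k) (P ℓ) (k + 1) (ℓ + 1)) ×
    (k < ℓ → ¬ 2 ∣ k → ¬ 2 ∣ ℓ →
    IsC (P k) (P ℓ) (k + ℓ ∸ ℓ % suc k) ((ℓ / suc k + 1) * ℓ)))
theorem3p3 k ℓ 1≤k _ =
  case-longer (parity k) (parity ℓ) ,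
  (λ 2∤k 2∣ℓ → subst (λ p → IsC (P k) (P ℓ) p ℓ) (+-comm 1 k) (case-odd-even (parity k) (parity ℓ) 2∤k 2∣ℓ)) ,
  (λ k<ℓ 2∣k → subst₂ (λ p q → IsC (P k) (P ℓ) p q) (+-comm 1 k) (+-comm 1 ℓ)
    (case-even-shorter (parity k) (parity ℓ) 1≤k k<ℓ 2∣k)) ,
  (λ _ → case-odd-shorter k ℓ)
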